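{- Set Cover $L$-reduces to MinCore.
   Context: Set Cover: given a universe $U$ of $n$ elements and a set $S=\{S_1,\dots,S_m\}$ of subsets of $U$ with $\bigcup_{i=1}^m S_i=U$, find a set $T\subseteq S$ of minimum cardinality with $\bigcup_{S_i\in T}S_i=U$ (the cost is $|T|$). MinCore: given a hypergraph $H=(V,E)$ (a finite set $V$ of vertices and a finite family $E$ of subsets of $V$ of arbitrary size, the edges), find a core of $H$ of minimum cardinality (the cost is the cardinality of the core). A core of $H$ is a set $C\subseteq V$ causing the following program to output $1$: (1) Remove all edges $e\in E$ with $e\subseteq C$. (2) While $E$ is non-empty: (a) if there exists $e\in E$ with $|e\cap C|=|e|-1$, set $C:=C\cup e$; (b) else return $0$; (c) remove all edges $e\in E$ with $e\cap C=e$. (3) Return $1$. In addition every vertex of $V$ has to lie in the final set $C$ (every vertex gets activated). A problem $\Pi$ $L$-reduces to a problem $\Pi'$ if there are two polynomial-time algorithms $f,g$ and constants $\alpha,\beta>0$ such that for each instance $I$ of $\Pi$: (1) $f$ produces an instance $I'=f(I)$ of $\Pi'$ such that the optima satisfy $\mathrm{OPT}(I')\le\alpha\cdot\mathrm{OPT}(I)$; (2) given any solution of $I'$ with cost $c'$, $g$ produces a solution of $I$ with cost $c$ such that $|c-\mathrm{OPT}(I)|\le\beta\,|c'-\mathrm{OPT}(I')|$. -}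

module Defs where

open import Data.Bool using (Bool; true; false)
import Data.Bool.Properties as Bool
open import Data.Fin using (Fin)
open import Data.Fin.Subset using (Subset; _∈_; _⊆_; _∩_; _∪_; ⊤; ∣_∣)
open import Data.Fin.Subset.Properties using (_⊆?_)
open import Data.Integer using (+_)
open import Data.List using (List; []; foldr; map; filter; replicate)
import Data.List.Membership.Propositional as List
open import Data.Nat using (ℕ; suc; _+_; _*_; _^_; _≤_; ∣_-_∣)
open import Data.Product using (Σ; Σ-syntax; ∃; ∃-syntax; _×_; _,_)
import Data.Rational as ℚ
open import Data.Rational using (ℚ)
open import Data.Vec using (Vec; lookup; toList)
open import Data.Vec.Properties using (≡-dec)
open import Data.Vec.Relation.Unary.Unique.Propositional using (Unique)
open import Relation.Binary.PropositionalEquality using (_≡_)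
open import Relation.Nullary using (¬?)

------------------------------------------------------------------------
-- Polynomial-time algorithms
--
-- The machine model is Jones' WHILE language with a single variable
-- holding a binary tree ("Computability and Complexity from a
-- Programming Perspective", 1997).  It is Turing-complete.

data Tree : Set where
  nil : Tree
  _∙_ : Tree → Tree → Tree

infixr 5 _∙_

size : Tree → ℕ
size nil     = 1
size (x ∙ y) = 1 + size x + size y

data Prog : Set where
  `id `nil `hd `tl : Prog
  `pair            : Prog → Prog → Prog
  _⨾_              : Prog → Prog → Prog
  `if_then_else_   : Prog → Prog → Prog → Prog
  `while_loop_       : Prog → Prog → Prog

infixr 4 _⨾_

-- p ⊢ x ⇓ y [ t ]: on input x, program p halts with output y in time t.
-- In tests nil means false and every other tree means true.
--
-- Every construct that is executed is charged the size of the tree it is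
-- applied to.  Charging one unit instead would be unsound:
-- iterating `pair `id `id builds a tree of exponential size in linearly
-- many steps.  With the present charge the size of an output never exceeds
-- the time, so running times agree with those of Turing machines up to a
-- polynomial.

infix 3 _⊢_⇓_[_]

data _⊢_⇓_[_] : Prog → Tree → Tree → ℕ → Set where
  id⇓ : ∀ {x} → `id ⊢ x ⇓ x [ size x ]

  nil⇓ : ∀ {x} → `nil ⊢ x ⇓ nil [ size x ]

  hd-nil⇓ : `hd ⊢ nil ⇓ nil [ size nil ]
  hd⇓     : ∀ {x y} → `hd ⊢ x ∙ y ⇓ x [ size (x ∙ y) ]

  tl-nil⇓ : `tl ⊢ nil ⇓ nil [ size nil ]
  tl⇓     : ∀ {x y} → `tl ⊢ x ∙ y ⇓ y [ size (x ∙ y) ]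

  pair⇓ : ∀ {p q x y z s t} →
          p ⊢ x ⇓ y [ s ] → q ⊢ x ⇓ z [ t ] →
          `pair p q ⊢ x ⇓ y ∙ z [ size x + s + t ]

  seq⇓ : ∀ {p q x y z s t} →
         p ⊢ x ⇓ y [ s ] → q ⊢ y ⇓ z [ t ] →
         p ⨾ q ⊢ x ⇓ z [ size x + s + t ]

  if-true⇓ : ∀ {b p q x u v y s t} →
             b ⊢ x ⇓ u ∙ v [ s ] → p ⊢ x ⇓ y [ t ] →
             `if b then p else q ⊢ x ⇓ y [ size x + s + t ]

  if-false⇓ : ∀ {b p q x y s t} →
              b ⊢ x ⇓ nil [ s ] → q ⊢ x ⇓ y [ t ] →
              `if b then p else q ⊢ x ⇓ y [ size x + s + t ]

  while-done⇓ : ∀ {b p x s} →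
                b ⊢ x ⇓ nil [ s ] →
                `while b loop p ⊢ x ⇓ x [ size x + s ]

  while-step⇓ : ∀ {b p x u v y z r s t} →
                b ⊢ x ⇓ u ∙ v [ r ] → p ⊢ x ⇓ y [ s ] →
                `while b loop p ⊢ y ⇓ z [ t ] →
                `while b loop p ⊢ x ⇓ z [ size x + r + s + t ]

-- Some program sends the tree (input a) to the tree (output a), for all
-- a : A, in time polynomial in the size of its input.  Since sizes are at
-- least 1, bounds of the form c · size ^ k cover all polynomials.

PolyTime : {A : Set} (input output : A → Tree) → Set
PolyTime {A} input output =
  ∃[ p ] ∃[ c ] ∃[ k ] ((a : A) →
    ∃[ t ] (p ⊢ input a ⇓ output a [ t ]) × t ≤ c * size (input a) ^ k)

encodeList : List Tree → Tree
encodeList = foldr _∙_ nil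

encodeBool : Bool → Tree
encodeBool false = nil
encodeBool true  = nil ∙ nil

encodeSubset : ∀ {n} → Subset n → Tree
encodeSubset p = encodeList (map encodeBool (toList p))

-- A ground set of n elements together with subsets of it, as an incidence
-- matrix.  The ground set is listed explicitly, so n is written in unary.

encodeSystem : ∀ n → List (Subset n) → Tree
encodeSystem n ps = encodeList (replicate n nil) ∙ encodeList (map encodeSubset ps)

------------------------------------------------------------------------
-- Minimisation problems and L-reductions

record MinProblem : Set₁ where
  field
    Instance       : Set
    Solution       : Instance → Set
    cost           : ∀ I → Solution I → ℕ
    encodeInstance : Instance → Tree
    encodeSolution : ∀ I → Solution I → Tree

  -- For an instance with a solution the optimum is unique and classically
  -- exists; statements quantify over k with IsOPT I k, so that no problem
  -- has to come with an algorithm for its optimum.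
  IsOPT : Instance → ℕ → Set
  IsOPT I k = (Σ[ s ∈ Solution I ] cost I s ≡ k) × (∀ (s : Solution I) → k ≤ cost I s)

fromℕ : ℕ → ℚ
fromℕ n = + n ℚ./ 1

infix 4 _L-reduces-to_

-- As usual, g may consult the instance I besides the solution of f I.

record _L-reduces-to_ (Π Π′ : MinProblem) : Set where
  private
    module Π  = MinProblem Π
    module Π′ = MinProblem Π′
  field
    f : Π.Instance → Π′.Instance
    g : ∀ I → Π′.Solution (f I) → Π.Solution I

    f-polyTime : PolyTime Π.encodeInstance (λ I → Π′.encodeInstance (f I))
    g-polyTime : PolyTime {Σ[ I ∈ Π.Instance ] Π′.Solution (f I)}
      (λ (I , s) → Π.encodeInstance I ∙ Π′.encodeSolution (f I) s)
      (λ (I , s) → Π.encodeSolution I (g I s))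

    α β : ℚ
    α>0 : α ℚ.> ℚ.0ℚ
    β>0 : β ℚ.> ℚ.0ℚ

    OPT-bound : ∀ I {opt opt′} → Π.IsOPT I opt → Π′.IsOPT (f I) opt′ →
      fromℕ opt′ ℚ.≤ α ℚ.* fromℕ opt

    error-bound : ∀ I {opt opt′} → Π.IsOPT I opt → Π′.IsOPT (f I) opt′ →
      ∀ (s : Π′.Solution (f I)) →
      fromℕ ∣ Π.cost I (g I s) - opt ∣ ℚ.≤ β ℚ.* fromℕ ∣ Π′.cost (f I) s - opt′ ∣

------------------------------------------------------------------------
-- Set Cover

-- The subfamily T ⊆ S is given by its set of indices.

Covers : ∀ {n m} → Vec (Subset n) m → Subset m → Set
Covers {n} S T = ∀ (x : Fin n) → ∃[ i ] i ∈ T × x ∈ lookup S i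

record SetSystem : Set where
  field
    n m      : ℕ
    S        : Vec (Subset n) m
    distinct : Unique S
    covering : Covers S ⊤

SetCover : MinProblem
SetCover = record
  { Instance       = SetSystem
  ; Solution       = λ I → ∃ (Covers (SetSystem.S I))
  ; cost           = λ _ (T , _) → ∣ T ∣
  ; encodeInstance = λ I → encodeSystem (SetSystem.n I) (toList (SetSystem.S I))
  ; encodeSolution = λ _ (T , _) → encodeSubset T
  }

------------------------------------------------------------------------
-- MinCore

record Hypergraph : Set where
  field
    n : ℕ
    E : List (Subset n)

-- Loop E C D: some run of the while loop from edges E and vertex set C
-- returns 1 with final vertex set D.  A run that gets stuck on a nonempty
-- edge list returns 0 and has no derivation.  The answer and D do not
-- depend on the choice of e, so "some run" and "every run" agree.

data Loop {n : ℕ} : List (Subset n) → Subset n → Subset n → Set where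
  return-1 : ∀ {C} → Loop [] C C

  activate : ∀ {E C D} (e : Subset n) → e List.∈ E →
             suc ∣ e ∩ C ∣ ≡ ∣ e ∣ →
             Loop (filter (λ e′ → ¬? (≡-dec Bool._≟_ (e′ ∩ (C ∪ e)) e′)) E) (C ∪ e) D →
             Loop E C D

IsCore : (H : Hypergraph) → Subset (Hypergraph.n H) → Set
IsCore H C = ∃[ D ] Loop (filter (λ e → ¬? (e ⊆? C)) (Hypergraph.E H)) C D × D ≡ ⊤

MinCore : MinProblem
MinCore = record
  { Instance       = Hypergraph
  ; Solution       = λ H → ∃ (IsCore H)
  ; cost           = λ _ (C , _) → ∣ C ∣
  ; encodeInstance = λ H → encodeSystem (Hypergraph.n H) (Hypergraph.E H)
  ; encodeSolution = λ _ (C , _) → encodeSubset C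
  }

{-
Elements and sets of the system become vertices, each in two copies w and w′.  For a rule "A
implies w" take the edge A ∪ A′ ∪ {w′}.  It activates w′ once both copies of A are active; as it
contains the members of A twice, it never activates one of them unless its other copy is active
already.  So, up to identifying the copies, edges act as one-way implications.  The rules say that
a set implies its elements and that all elements together imply everything.  The indices of a
cover then form a core.  Conversely, run through the sets and discard from a core C the copies of
each set and of its elements, selecting the set if something is discarded.  This selects at most
|C| sets, and only vertices implied by the selected sets are ever activated, so they form a cover.
Hence optima are preserved and α = β = 1.

Polynomial time is closed under folds over lists whose step is polynomial and whose intermediate
results have polynomial size.  Both translations are compositions of such folds.
-}

module Submission where

open import Defs
open import Data.Bool using (Bool; true; false; _∧_; _∨_; not; if_then_else_)
open import Data.Bool.ListAction using (or)
import Data.Bool.Properties as Bool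
open import Data.Empty using (⊥-elim)
open import Data.Fin using (Fin; zero; suc; _↑ˡ_; _↑ʳ_; splitAt)
import Data.Fin.Properties as Fin
open import Data.Fin.Subset using (Subset; _∈_; _∉_; _⊆_; _∩_; _∪_; ⊤; ⊥; ⁅_⁆; ∣_∣)
open import Data.Fin.Subset.Properties using
  (_∈?_; _⊆?_; ∈⊤; ⊆⊤; ⊆-antisym; drop-there; x∈p∩q⁺; x∈p∩q⁻; x∈p∪q⁻; p⊆p∪q; q⊆p∪q;
   x∈⁅x⁆; x∈⁅y⁆⇒x≡y; ∣⊥∣≡0; ∣p∩q∣≤∣p∣)
import Data.Integer as ℤ
import Data.Integer.Properties as ℤ
open import Data.List using
  (List; []; _∷_; _++_; map; reverse; _ʳ++_; length; concat; concatMap; foldr; foldl; drop;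
   filter; tabulate)
import Data.List as List
open import Data.List.Membership.Propositional using (lose; find) renaming (_∈_ to _∈ᴸ_)
open import Data.List.Membership.Propositional.Properties using
  (∈-filter⁺; ∈-filter⁻; ∈-concatMap⁺; ∈-concatMap⁻; ∈-tabulate⁺; ∈-tabulate⁻; ∈-++⁺ˡ; ∈-++⁺ʳ;
   ∈-++⁻)
import Data.List.Properties as List
open import Data.List.Relation.Unary.Any using (here; there)
open import Data.Nat using
  (ℕ; zero; suc; _+_; _*_; _^_; _≤_; _<_; s≤s; z≤n; ∣_-_∣; NonZero; >-nonZero)
open import Data.Nat.Properties
open import Data.Nat.Tactic.RingSolver using (solve-∀)
open import Data.Product using (Σ-syntax; ∃; ∃-syntax; _×_; _,_; proj₁; proj₂; uncurry)
import Data.Rational as ℚ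
import Data.Rational.Properties as ℚ
import Data.Rational.Unnormalised as ℚᵘ
import Data.Rational.Unnormalised.Properties as ℚᵘ
open import Data.Sum using (_⊎_; inj₁; inj₂; [_,_]′)
open import Data.Vec as Vec using (Vec; []; _∷_; lookup; toList; replicate; _[_]≔_; here; there)
open import Data.Vec.Properties using
  ([]=⇒lookup; lookup⇒[]=; lookup-++ˡ; lookup-++ʳ; lookup-map; lookup-replicate; lookup∘update;
   lookup∘update′; lookup∘tabulate; ≡-dec; toList-map; toList-++; map-replicate)
open import Function using (_∘_; id; const; flip)
open import Relation.Binary.PropositionalEquality
open import Relation.Nullary using (Dec; ¬_; ¬?; yes; no; contradiction)

-- Polynomial time

size≥1 : ∀ x → 1 ≤ size x
size≥1 nil     = s≤s z≤n
size≥1 (x ∙ y) = s≤s z≤n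

-- The bound is measured on the encoded input `i a`, while the index `a` may carry data that the
-- tree does not show, such as a proof that a set is a core.
record Bounded {A : Set} (i : A → Tree) (b : A → ℕ) : Set where
  constructor bounded
  field
    coefficient degree : ℕ
    bound              : ∀ a → b a ≤ coefficient * size (i a) ^ degree

open Bounded

Bounded-mono : {A : Set} {i : A → Tree} {b b′ : A → ℕ} →
  (∀ a → b a ≤ b′ a) → Bounded i b′ → Bounded i b
Bounded-mono b≤b′ (bounded c k h) = bounded c k λ a → ≤-trans (b≤b′ a) (h a)

Bounded-const : {A : Set} {i : A → Tree} (n : ℕ) → Bounded i (λ _ → n)
Bounded-const n = bounded n 0 λ _ → ≤-reflexive (sym (*-identityʳ n))

Bounded-size : {A : Set} {i : A → Tree} → Bounded i (size ∘ i)
Bounded-size {i = i} = bounded 1 1 λ a → ≤-reflexive (sym (trans (*-identityˡ _) (^-identityʳ _)))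

Bounded-* : {A : Set} {i : A → Tree} {b b′ : A → ℕ} →
  Bounded i b → Bounded i b′ → Bounded i (λ a → b a * b′ a)
Bounded-* {i = i} (bounded c k h) (bounded c′ k′ h′) = bounded (c * c′) (k + k′) λ a →
  let n = size (i a) in
  ≤-trans (*-mono-≤ (h a) (h′ a)) (≤-reflexive
    (trans ([m*n]*[o*p]≡[m*o]*[n*p] c (n ^ k) c′ (n ^ k′))
           (cong (c * c′ *_) (sym (^-distribˡ-+-* n k k′)))))

Bounded-^ : {A : Set} {i : A → Tree} {b : A → ℕ} →
  Bounded i b → ∀ k → Bounded i (λ a → b a ^ k)
Bounded-^ h zero    = Bounded-const 1
Bounded-^ h (suc k) = Bounded-* h (Bounded-^ h k)

-- Both degrees are raised to `k + k′`, which does not decrease the powers because sizes are at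
-- least 1.
Bounded-+ : {A : Set} {i : A → Tree} {b b′ : A → ℕ} →
  Bounded i b → Bounded i b′ → Bounded i (λ a → b a + b′ a)
Bounded-+ {i = i} (bounded c k h) (bounded c′ k′ h′) = bounded (c + c′) (k + k′) λ a →
  let n = size (i a)
      instance n≢0 : NonZero n
               n≢0 = >-nonZero (size≥1 (i a))
  in ≤-trans
       (+-mono-≤ (≤-trans (h a) (*-monoʳ-≤ c (^-monoʳ-≤ n (m≤m+n k k′))))
                 (≤-trans (h′ a) (*-monoʳ-≤ c′ (^-monoʳ-≤ n (m≤n+m k′ k)))))
       (≤-reflexive (sym (*-distribʳ-+ (n ^ (k + k′)) c c′)))

Bounded-trans : {A : Set} {i j : A → Tree} {b : A → ℕ} →
  Bounded i (size ∘ j) → Bounded j b → Bounded i b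
Bounded-trans h (bounded c k h′) = Bounded-mono h′ (Bounded-* (Bounded-const c) (Bounded-^ h k))

Bounded-reindex : {A B : Set} {i : A → Tree} {b : A → ℕ} (h : B → A) →
  Bounded i b → Bounded (i ∘ h) (b ∘ h)
Bounded-reindex h (bounded c k p) = bounded c k (p ∘ h)

-- This is what makes polynomial time compose: an intermediate tree is polynomial in the input
-- because the time to produce it is, hence so is the time of any polynomial program run on it.
output-size : ∀ {p x y t} → p ⊢ x ⇓ y [ t ] → size y ≤ t
output-size id⇓          = ≤-refl
output-size (nil⇓ {x})   = size≥1 x
output-size hd-nil⇓      = ≤-refl
output-size (hd⇓ {x} {y})  = ≤-trans (n≤1+n _) (m≤m+n (suc (size x)) (size y))
output-size tl-nil⇓      = ≤-refl
output-size (tl⇓ {x} {y})  = m≤n+m (size y) (suc (size x))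
output-size (pair⇓ {x = x} p q) = +-mono-≤ (+-mono-≤ (size≥1 x) (output-size p)) (output-size q)
output-size (seq⇓ p q)          = ≤-trans (output-size q) (m≤n+m _ _)
output-size (if-true⇓ p q)      = ≤-trans (output-size q) (m≤n+m _ _)
output-size (if-false⇓ p q)     = ≤-trans (output-size q) (m≤n+m _ _)
output-size (while-done⇓ p)     = m≤m+n _ _
output-size (while-step⇓ p q r) = ≤-trans (output-size r) (m≤n+m _ _)

-- Polynomial-time programs and their composition

record Poly {A : Set} (i o : A → Tree) : Set where
  field
    prog         : Prog
    time         : A → ℕ
    runs         : ∀ a → prog ⊢ i a ⇓ o a [ time a ]
    time-bounded : Bounded i time

open Poly

toPolyTime : {A : Set} {i o : A → Tree} → Poly i o → PolyTime i o
toPolyTime p = let bounded c k h = time-bounded p in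
  prog p , c , k , λ a → time p a , runs p a , h a

output-bounded : {A : Set} {i o : A → Tree} → Poly i o → Bounded i (size ∘ o)
output-bounded p = Bounded-mono (output-size ∘ runs p) (time-bounded p)

congP : {A : Set} {i o o′ : A → Tree} → (∀ a → o a ≡ o′ a) → Poly i o → Poly i o′
congP o≗o′ p = record
  { prog         = prog p
  ; time         = time p
  ; runs         = λ a → subst (prog p ⊢ _ ⇓_[ time p a ]) (o≗o′ a) (runs p a)
  ; time-bounded = time-bounded p
  }

congInputP : {A : Set} {i i′ o : A → Tree} → (∀ a → i a ≡ i′ a) → Poly i o → Poly i′ o
congInputP {i′ = i′} {o} i≗i′ p = record
  { runs         = λ a → subst (λ x → prog p ⊢ x ⇓ o a [ time p a ]) (i≗i′ a) (runs p a)
  ; time-bounded = let bounded c k h = time-bounded p in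
      bounded c k λ a → subst (λ x → time p a ≤ c * size x ^ k) (i≗i′ a) (h a)
  }

-- A program sees only trees, so the index can be changed without touching it. In this way a program
-- about one item is reused in a loop whose index also records the state.
reindexP : {A B : Set} {i o : A → Tree} (h : B → A) → Poly i o → Poly (i ∘ h) (o ∘ h)
reindexP h p = record
  { prog         = prog p
  ; time         = time p ∘ h
  ; runs         = runs p ∘ h
  ; time-bounded = Bounded-reindex h (time-bounded p)
  }

idP : {A : Set} {i : A → Tree} → Poly i i
idP = record { runs = λ _ → id⇓ ; time-bounded = Bounded-size }

nilP : {A : Set} {i : A → Tree} → Poly i (λ _ → nil)
nilP = record { runs = λ _ → nil⇓ ; time-bounded = Bounded-size }

pairP : {A : Set} {i o o′ : A → Tree} → Poly i o → Poly i o′ → Poly i (λ a → o a ∙ o′ a)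
pairP p q = record
  { runs         = λ a → pair⇓ (runs p a) (runs q a)
  ; time-bounded = Bounded-+ (Bounded-+ Bounded-size (time-bounded p)) (time-bounded q)
  }

_then_ : {A : Set} {i m o : A → Tree} → Poly i m → Poly m o → Poly i o
p then q = record
  { runs         = λ a → seq⇓ (runs p a) (runs q a)
  ; time-bounded = Bounded-+ (Bounded-+ Bounded-size (time-bounded p))
                             (Bounded-trans (output-bounded p) (time-bounded q))
  }

hdP : {A : Set} {i o o′ : A → Tree} → Poly i (λ a → o a ∙ o′ a) → Poly i o
hdP p = p then record { runs = λ _ → hd⇓ ; time-bounded = Bounded-size }

tlP : {A : Set} {i o o′ : A → Tree} → Poly i (λ a → o a ∙ o′ a) → Poly i o′
tlP p = p then record { runs = λ _ → tl⇓ ; time-bounded = Bounded-size }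

ifP : {A : Set} {i o o′ : A → Tree} {b : A → Bool} →
  Poly i (encodeBool ∘ b) → Poly i o → Poly i o′ → Poly i (λ a → if b a then o a else o′ a)
ifP {i = i} {o} {o′} {b} p q r = record
  { prog         = `if prog p then prog q else prog r
  ; time         = λ a → size (i a) + time p a + (if b a then time q a else time r a)
  ; runs         = λ a → branch (b a) (runs p a) (runs q a) (runs r a)
  ; time-bounded = Bounded-+ (Bounded-+ Bounded-size (time-bounded p))
      (Bounded-mono (λ a → if≤+ (b a)) (Bounded-+ (time-bounded q) (time-bounded r)))
  }
  where
  if≤+ : ∀ c {m n} → (if c then m else n) ≤ m + n
  if≤+ true  = m≤m+n _ _
  if≤+ false = m≤n+m _ _

  branch : ∀ c {x y z s t u} → prog p ⊢ x ⇓ encodeBool c [ s ] →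
    prog q ⊢ x ⇓ y [ t ] → prog r ⊢ x ⇓ z [ u ] →
    `if prog p then prog q else prog r ⊢ x ⇓ (if c then y else z)
      [ size x + s + (if c then t else u) ]
  branch true  = λ p q r → if-true⇓ p q
  branch false = λ p q r → if-false⇓ p r

-- The same as encodeList ∘ map enc, but injective for unification because it is defined by
-- recursion.
encL : {X : Set} → (X → Tree) → List X → Tree
encL enc []       = nil
encL enc (x ∷ xs) = enc x ∙ encL enc xs

length<size : {X : Set} (enc : X → Tree) (xs : List X) → suc (length xs) ≤ size (encL enc xs)
length<size enc []       = ≤-refl
length<size enc (x ∷ xs) = s≤s (≤-trans (length<size enc xs) (m≤n+m _ _))

-- The state (zs , ys) of the loop holds the unread and, reversed, the read part of the list.
loopP : {A X : Set} {i : A → Tree} {enc : X → Tree} {out : A → List X → Tree} →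
  Bounded {A × List X} (λ (a , ys) → encL enc ys ∙ i a) (λ (a , ys) → size (out a ys)) →
  Poly {A × X × List X × List X}
    (λ (a , x , zs , ys) → (enc x ∙ encL enc zs) ∙ (out a ys ∙ i a))
    (λ (a , x , zs , ys) → encL enc zs ∙ (out a (x ∷ ys) ∙ i a)) →
  Poly {A × List X} (λ (a , xs) → encL enc xs ∙ (out a [] ∙ i a))
                    (λ (a , xs) → nil ∙ (out a (reverse xs) ∙ i a))
loopP {A} {X} {i} {enc} {out} (bounded c₀ k₀ out≤) body = record
  { prog         = `while `hd loop prog body
  ; time         = λ (a , xs) → loopTime a xs []
  ; runs         = λ (a , xs) → loopRuns a xs []
  ; time-bounded = Bounded-mono
      (λ (a , xs) → ≤-trans
        (loopTime≤ a xs xs [] (≤-reflexive (+-comm (size (encL enc xs)) 1)))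
        (*-monoˡ-≤ (K (a , xs)) (≤-trans (length<size enc xs)
          (≤-trans (m≤m+n _ _) (n≤1+n _)))))
      (Bounded-* Bounded-size K-bounded)
  }
  where
  state : A → List X → List X → Tree
  state a zs ys = encL enc zs ∙ (out a ys ∙ i a)

  loopTime : A → List X → List X → ℕ
  loopTime a []       ys = size (state a [] ys) + size (state a [] ys)
  loopTime a (x ∷ zs) ys = size (state a (x ∷ zs) ys) + size (state a (x ∷ zs) ys)
    + time body (a , x , zs , ys) + loopTime a zs (x ∷ ys)

  loopRuns : ∀ a zs ys → `while `hd loop prog body ⊢ state a zs ys
    ⇓ nil ∙ (out a (zs ʳ++ ys) ∙ i a) [ loopTime a zs ys ]
  -- The test `hd` returns the unread list, which is `nil`, hence false, exactly when nothing is
  -- left to read.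
  loopRuns a []       ys = while-done⇓ hd⇓
  loopRuns a (x ∷ zs) ys = while-step⇓ hd⇓ (runs body (a , x , zs , ys)) (loopRuns a zs (x ∷ ys))

  initial : A × List X → Tree
  initial (a , xs) = state a xs []

  -- `M` bounds the size of every state that occurs, `K` the cost of one round: the charge for the
  -- loop itself, the test and the body.
  M K : A × List X → ℕ
  M s = size (initial s) + c₀ * size (initial s) ^ k₀
  K s = M s + M s + coefficient (time-bounded body) * M s ^ degree (time-bounded body)

  M-bounded : Bounded initial M
  M-bounded = Bounded-+ Bounded-size (Bounded-* (Bounded-const c₀) (Bounded-^ Bounded-size k₀))

  K-bounded : Bounded initial K
  K-bounded = Bounded-+ (Bounded-+ M-bounded M-bounded)
    (Bounded-* (Bounded-const (coefficient (time-bounded body)))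
               (Bounded-^ M-bounded (degree (time-bounded body))))

  -- Moving an item from the unread to the read part preserves the sum of the two encoded sizes.
  -- Initially it is one more than the size of `xs`, owing to the `nil` of the empty read part.
  state≤M : ∀ a xs zs ys → size (encL enc zs) + size (encL enc ys) ≤ suc (size (encL enc xs)) →
    size (state a zs ys) ≤ M (a , xs)
  state≤M a xs zs ys h = begin
    size (state a zs ys)                       ≡⟨ rearrange Z O I ⟩
    suc (Z + suc I) + O                        ≤⟨ +-mono-≤ (s≤s (+-mono-≤ Z≤ (s≤s (m≤n+m I _)))) O≤ ⟩
    M (a , xs)                                 ∎
    where
    open ≤-Reasoning
    Z O I L : ℕ
    Z = size (encL enc zs)
    O = size (out a ys)
    I = size (i a)
    L = size (encL enc xs)
    rearrange : ∀ z o i → suc (z + suc (o + i)) ≡ suc (z + suc i) + o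
    rearrange = solve-∀
    Z≤ : Z ≤ L
    Z≤ = +-cancelʳ-≤ 1 Z L (≤-trans (+-monoʳ-≤ Z (size≥1 (encL enc ys)))
                                    (≤-trans h (≤-reflexive (+-comm 1 L))))
    Y≤ : size (encL enc ys) ≤ L
    Y≤ = +-cancelˡ-≤ 1 _ _ (≤-trans (+-monoˡ-≤ _ (size≥1 (encL enc zs))) h)
    O≤ : O ≤ c₀ * size (initial (a , xs)) ^ k₀
    O≤ = ≤-trans (out≤ (a , ys)) (*-monoʳ-≤ c₀ (^-monoˡ-≤ k₀
           (s≤s (+-mono-≤ Y≤ (≤-trans (m≤n+m I (size (out a []))) (n≤1+n _))))))

  -- There is one round for each unread item and one for the final test.
  loopTime≤ : ∀ a xs zs ys → size (encL enc zs) + size (encL enc ys) ≤ suc (size (encL enc xs)) →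
    loopTime a zs ys ≤ suc (length zs) * K (a , xs)
  loopTime≤ a xs [] ys h = ≤-trans (+-mono-≤ st st)
    (≤-trans (m≤m+n _ _) (≤-reflexive (sym (+-identityʳ (K (a , xs))))))
    where st = state≤M a xs [] ys h
  loopTime≤ a xs (x ∷ zs) ys h =
    +-mono-≤
      (+-mono-≤ (+-mono-≤ st st)
        (≤-trans (bound (time-bounded body) (a , x , zs , ys))
          (*-monoʳ-≤ (coefficient (time-bounded body))
                      (^-monoˡ-≤ (degree (time-bounded body)) st))))
      (loopTime≤ a xs zs (x ∷ ys) (≤-trans
        (≤-reflexive (move (size (enc x)) (size (encL enc zs)) (size (encL enc ys)))) h))
    where
    st = state≤M a xs (x ∷ zs) ys h
    move : ∀ x z y → z + suc (x + y) ≡ suc (x + z) + y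
    move = solve-∀

-- The accumulator is specified as a function of the part ys of the list that has been read.
foldReverseP : {A X : Set} {i : A → Tree} {enc : X → Tree} {xs : A → List X}
  (out : A → List X → Tree) →
  Bounded {A × List X} (λ (a , ys) → encL enc ys ∙ i a) (λ (a , ys) → size (out a ys)) →
  Poly i (λ a → out a []) →
  Poly {A × X × List X} (λ (a , x , ys) → (enc x ∙ out a ys) ∙ i a)
                        (λ (a , x , ys) → out a (x ∷ ys)) →
  Poly i (λ a → encL enc (xs a)) →
  Poly i (λ a → out a (reverse (xs a)))
foldReverseP {xs = xs} out bd base step list =
  -- The state is assembled from the list, the initial accumulator and a copy of the input; the
  -- accumulator is projected out at the end. The body hands `step` the item, the accumulator and
  -- the input, and passes the unread tail on by itself.
  hdP (tlP (pairP list (pairP base idP) then reindexP (λ a → a , xs a) (loopP bd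
    (pairP (tlP (hdP idP)) (pairP
      (pairP (pairP (hdP (hdP idP)) (hdP (tlP idP))) (tlP (tlP idP))
        then reindexP (λ (a , x , zs , ys) → a , x , ys) step)
      (tlP (tlP idP)))))))

-- The tree `enc x ∙ encL enc ys` already encodes `x ∷ ys`, so the step is a single `hd`.
reverseP : {A X : Set} {i : A → Tree} {enc : X → Tree} {xs : A → List X} →
  Poly i (λ a → encL enc (xs a)) → Poly i (λ a → encL enc (reverse (xs a)))
reverseP {enc = enc} = foldReverseP (λ _ ys → encL enc ys)
  (Bounded-mono (λ _ → ≤-trans (m≤m+n _ _) (n≤1+n _)) Bounded-size)
  nilP (hdP idP)

-- Reversing the list first makes the parts already read the suffixes of `xs`, so that `step`
-- computes a right fold.
foldP : {A X : Set} {i : A → Tree} {enc : X → Tree} {xs : A → List X}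
  (out : A → List X → Tree) →
  Bounded {A × List X} (λ (a , ys) → encL enc ys ∙ i a) (λ (a , ys) → size (out a ys)) →
  Poly i (λ a → out a []) →
  Poly {A × X × List X} (λ (a , x , ys) → (enc x ∙ out a ys) ∙ i a)
                        (λ (a , x , ys) → out a (x ∷ ys)) →
  Poly i (λ a → encL enc (xs a)) →
  Poly i (λ a → out a (xs a))
foldP {enc = enc} {xs = xs} out bd base step list =
  congP (λ a → cong (out a) (List.reverse-involutive (xs a)))
    (foldReverseP {enc = enc} {xs = reverse ∘ xs} out bd base step (reverseP {enc = enc} list))

itemP : {A X S : Set} {i : A → Tree} {enc : X → Tree} {out : A → S → Tree} →
  Poly {A × X × S} (λ (a , x , s) → (enc x ∙ out a s) ∙ i a) (λ (a , x , s) → enc x)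
itemP = hdP (hdP idP)

accP : {A X S : Set} {i : A → Tree} {enc : X → Tree} {out : A → S → Tree} →
  Poly {A × X × S} (λ (a , x , s) → (enc x ∙ out a s) ∙ i a) (λ (a , x , s) → out a s)
accP = tlP (hdP idP)

envP : {A X : Set} {i o : A → Tree} {enc : A × X → Tree} →
  Poly i o → Poly {A × X} (λ (a , x) → enc (a , x) ∙ i a) (λ (a , x) → o a)
envP p = tlP idP then reindexP proj₁ p

-- If each item adds at most a polynomial amount `δ`, the accumulator is at most the number of items
-- times a polynomial. This discharges the size condition of `mapP`, `appendP`, `concatP` and
-- `zipPadP`.
Bounded-additive : {A X : Set} {i : A → Tree} {enc : X → Tree}
  (out : A → List X → Tree) (δ : A → X → ℕ) →
  Bounded {A × X} (λ (a , x) → enc x ∙ i a) (λ (a , x) → δ a x) →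
  Bounded i (λ a → size (out a [])) →
  (∀ a x ys → size (out a (x ∷ ys)) ≤ δ a x + size (out a ys)) →
  Bounded {A × List X} (λ (a , ys) → encL enc ys ∙ i a) (λ (a , ys) → size (out a ys))
Bounded-additive {A} {X} {i} {enc} out δ (bounded c k δ≤) base grow =
  Bounded-mono (λ (a , ys) → total a ys (size (encL enc ys ∙ i a)) ≤-refl)
    (Bounded-+ (Bounded-* length-bounded (Bounded-* (Bounded-const c) (Bounded-^ Bounded-size k)))
               (Bounded-trans (output-bounded (tlP {o = λ (a , ys) → encL enc ys} idP))
                              (Bounded-reindex proj₁ base)))
  where
  length-bounded : Bounded {A × List X} (λ (a , ys) → encL enc ys ∙ i a) (length ∘ proj₂)
  length-bounded = Bounded-mono
    (λ (a , ys) → ≤-trans (n≤1+n _)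
      (≤-trans (length<size enc ys) (≤-trans (m≤m+n _ _) (n≤1+n _))))
    Bounded-size

  -- `n` stays fixed while the list shrinks, so every item is charged the same amount.
  total : ∀ a ys n → size (encL enc ys ∙ i a) ≤ n →
    size (out a ys) ≤ length ys * (c * n ^ k) + size (out a [])
  total a []       n h = ≤-refl
  total a (x ∷ ys) n h = ≤-trans (grow a x ys)
    (≤-trans (+-mono-≤ (≤-trans (δ≤ (a , x)) (*-monoʳ-≤ c (^-monoˡ-≤ k (part (m≤m+n _ _)))))
                       (total a ys n (part (m≤n+m _ _))))
             (≤-reflexive (sym (+-assoc (c * n ^ k) _ _))))
    where
    part : ∀ {l} → l ≤ size (enc x) + size (encL enc ys) → suc (l + size (i a)) ≤ n
    part l≤ = ≤-trans (s≤s (+-monoˡ-≤ (size (i a)) (≤-trans l≤ (n≤1+n _)))) h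

-- List operations as folds

mapP : {A X Y : Set} {i : A → Tree} {encX : X → Tree} {encY : Y → Tree} {xs : A → List X}
  {f : A → X → Y} →
  Poly {A × X} (λ (a , x) → encX x ∙ i a) (λ (a , x) → encY (f a x)) →
  Poly i (λ a → encL encX (xs a)) → Poly i (λ a → encL encY (map (f a) (xs a)))
mapP {encY = encY} {f = f} p list = foldP (λ a ys → encL encY (map (f a) ys))
  (Bounded-additive (λ a ys → encL encY (map (f a) ys)) (λ a x → suc (size (encY (f a x))))
    (Bounded-+ (Bounded-const 1) (output-bounded p)) (Bounded-const 1) (λ _ _ _ → ≤-refl))
  nilP
  (pairP (pairP itemP (tlP idP) then reindexP (λ (a , x , _) → a , x) p) accP)
  list

size-++ : {X : Set} (enc : X → Tree) (xs ys : List X) →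
  size (encL enc (xs ++ ys)) ≤ size (encL enc xs) + size (encL enc ys)
size-++ enc []       ys = n≤1+n _
size-++ enc (x ∷ xs) ys = s≤s (≤-trans (+-monoʳ-≤ (size (enc x)) (size-++ enc xs ys))
                                       (≤-reflexive (sym (+-assoc (size (enc x)) _ _))))

appendP : {A X : Set} {i : A → Tree} {enc : X → Tree} {xs ys : A → List X} →
  Poly i (λ a → encL enc (xs a)) → Poly i (λ a → encL enc (ys a)) →
  Poly i (λ a → encL enc (xs a ++ ys a))
appendP {enc = enc} {ys = ys} p q = foldP (λ a zs → encL enc (zs ++ ys a))
  (Bounded-additive (λ a zs → encL enc (zs ++ ys a)) (λ a x → suc (size (enc x)))
    (Bounded-mono (λ (a , x) → s≤s (m≤m+n _ _)) Bounded-size) (output-bounded q)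
    (λ _ _ _ → ≤-refl))
  q (pairP itemP accP) p

concatP : {A X : Set} {i : A → Tree} {enc : X → Tree} {xss : A → List (List X)} →
  Poly i (λ a → encL (encL enc) (xss a)) → Poly i (λ a → encL enc (concat (xss a)))
concatP {enc = enc} = foldP (λ _ xss → encL enc (concat xss))
  (Bounded-additive (λ _ xss → encL enc (concat xss)) (λ a xs → size (encL enc xs))
    (Bounded-mono (λ _ → ≤-trans (m≤m+n _ _) (n≤1+n _)) Bounded-size) (Bounded-const 1)
    (λ _ xs xss → size-++ enc xs (concat xss)))
  nilP (appendP itemP accP)

headOr : {Y : Set} → Y → List Y → Y
headOr d []      = d
headOr d (y ∷ _) = y

-- Since `hd` sends `nil` to `nil`, a default encoded as `nil` is produced without a test for
-- emptiness.
headP : {A Y : Set} {i : A → Tree} {enc : Y → Tree} {d : Y} {ys : A → List Y} → enc d ≡ nil →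
  Poly i (λ a → encL enc (ys a)) → Poly i (λ a → enc (headOr d (ys a)))
headP {enc = enc} {d} {ys} d≡nil p =
  p then record { runs = λ a → run (ys a) ; time-bounded = Bounded-size }
  where
  run : ∀ zs → `hd ⊢ encL enc zs ⇓ enc (headOr d zs) [ size (encL enc zs) ]
  run []      rewrite d≡nil = hd-nil⇓
  run (_ ∷ _) = hd⇓

tailP : {A Y : Set} {i : A → Tree} {enc : Y → Tree} {ys : A → List Y} →
  Poly i (λ a → encL enc (ys a)) → Poly i (λ a → encL enc (drop 1 (ys a)))
tailP {enc = enc} {ys} p =
  p then record { runs = λ a → run (ys a) ; time-bounded = Bounded-size }
  where
  run : ∀ zs → `tl ⊢ encL enc zs ⇓ encL enc (drop 1 zs) [ size (encL enc zs) ]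
  run []      = tl-nil⇓
  run (_ ∷ _) = tl⇓

encP : {X Y : Set} → (X → Tree) → (Y → Tree) → X × Y → Tree
encP encX encY (x , y) = encX x ∙ encY y

-- The second list is truncated or padded with d to the length of the first.
zipPad : {X Y : Set} → Y → List X → List Y → List (X × Y)
zipPad d []       ys = []
zipPad d (x ∷ xs) ys = (x , headOr d ys) ∷ zipPad d xs (drop 1 ys)

-- Folded over the reversed list: the first component holds the unread part of the second list.
zipStep : {X Y : Set} → Y → X → List Y × List (X × Y) → List Y × List (X × Y)
zipStep d x (ys , acc) = drop 1 ys , (x , headOr d ys) ∷ acc

foldl-zipStep : {X Y : Set} (d : Y) (xs : List X) (ys : List Y) (acc : List (X × Y)) →
  proj₂ (foldl (flip (zipStep d)) (ys , acc) xs) ≡ zipPad d xs ys ʳ++ acc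
foldl-zipStep d []       ys acc = refl
foldl-zipStep d (x ∷ xs) ys acc = foldl-zipStep d xs (drop 1 ys) ((x , headOr d ys) ∷ acc)

reverse-zipPad : {X Y : Set} (d : Y) (xs : List X) (ys : List Y) →
  reverse (proj₂ (foldr (zipStep d) (ys , []) (reverse xs))) ≡ zipPad d xs ys
reverse-zipPad d xs ys = begin
  reverse (proj₂ (foldr (zipStep d) (ys , []) (reverse xs)))
    ≡⟨ cong (reverse ∘ proj₂) (List.reverse-foldr (zipStep d) (ys , []) xs) ⟩
  reverse (proj₂ (foldl (flip (zipStep d)) (ys , []) xs))
    ≡⟨ cong reverse (foldl-zipStep d xs ys []) ⟩
  reverse (reverse (zipPad d xs ys))
    ≡⟨ List.reverse-involutive _ ⟩
  zipPad d xs ys ∎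
  where open ≡-Reasoning

-- Both lists have to be consumed from the front, hence `foldReverseP`, whose loop reads `xs` in
-- order. The pairs accumulate in reverse, and `reverseP` restores their order.
zipPadP : {A X Y : Set} {i : A → Tree} {encX : X → Tree} {encY : Y → Tree} {d : Y}
  {xs : A → List X} {ys : A → List Y} → encY d ≡ nil →
  Poly i (λ a → encL encX (xs a)) → Poly i (λ a → encL encY (ys a)) →
  Poly i (λ a → encL (encP encX encY) (zipPad d (xs a) (ys a)))
zipPadP {A} {X} {Y} {i} {encX} {encY} {d} {xs} {ys} d≡nil p q =
  congP (λ a → cong (encL (encP encX encY)) (reverse-zipPad d (xs a) (ys a)))
    (reverseP (tlP {o = λ a → encL encY (proj₁ (zipped a (reverse (xs a))))}
      (foldReverseP out
        (Bounded-additive out (λ a x → 3 + size (encX x))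
          (Bounded-mono (λ (a , x) → +-monoʳ-≤ 3 (≤-trans (m≤m+n _ _) (n≤1+n _)))
            (Bounded-+ (Bounded-const 3) Bounded-size))
          (output-bounded (pairP q nilP))
          grow)
        (pairP q nilP)
        (pairP (tailP (hdP accP)) (pairP (pairP itemP (headP d≡nil (hdP accP))) (tlP accP)))
        p)))
  where
  zipped : A → List X → List Y × List (X × Y)
  zipped a = foldr (zipStep d) (ys a , [])

  out : A → List X → Tree
  out a zs = encL encY (proj₁ (zipped a zs)) ∙ encL (encP encX encY) (proj₂ (zipped a zs))

  -- The `suc` is for the empty list: its tail and the default are two trees `nil`, obtained from
  -- one.
  uncons : ∀ zs → size (encL encY (drop 1 zs)) + size (encY (headOr d zs)) ≤ suc (size (encL encY zs))
  uncons [] rewrite d≡nil = ≤-refl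
  uncons (z ∷ zs) = ≤-trans (≤-reflexive (+-comm _ (size (encY z)))) (≤-trans (n≤1+n _) (n≤1+n _))

  -- The 3 counts the new cons node, the new pair node and the `suc` of `uncons`.
  grow : ∀ a x zs → size (out a (x ∷ zs)) ≤ 3 + size (encX x) + size (out a zs)
  grow a x zs with zipped a zs
  ... | r , acc = ≤-trans
        (≤-reflexive (before (size (encL encY (drop 1 r))) x′ (size (encY (headOr d r))) acc′))
        (≤-trans (+-monoˡ-≤ _ (uncons r)) (≤-reflexive (after x′ (size (encL encY r)) acc′)))
    where
    x′ acc′ : ℕ
    x′   = size (encX x)
    acc′ = size (encL (encP encX encY) acc)
    before : ∀ r x h s → suc (r + suc (suc (x + h) + s)) ≡ r + h + (3 + x + s)
    before = solve-∀
    after : ∀ x r s → suc r + (3 + x + s) ≡ 3 + x + suc (r + s)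
    after = solve-∀

-- Boolean operations and rows of bits

trueP : {A : Set} {i : A → Tree} → Poly i (λ _ → encodeBool true)
trueP = pairP nilP nilP

ifBoolP : {A : Set} {i : A → Tree} {b x y : A → Bool} →
  Poly i (encodeBool ∘ b) → Poly i (encodeBool ∘ x) → Poly i (encodeBool ∘ y) →
  Poly i (λ a → encodeBool (if b a then x a else y a))
ifBoolP {b = b} {x} {y} p q r = congP (λ a → push (b a)) (ifP p q r)
  where
  push : ∀ c {x y} → (if c then encodeBool x else encodeBool y) ≡ encodeBool (if c then x else y)
  push true  = refl
  push false = refl

∨P : {A : Set} {i : A → Tree} {x y : A → Bool} →
  Poly i (encodeBool ∘ x) → Poly i (encodeBool ∘ y) → Poly i (λ a → encodeBool (x a ∨ y a))
∨P {x = x} {y} p q = congP (λ a → cong encodeBool (eq (x a))) (ifBoolP p trueP q)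
  where
  eq : ∀ x {y} → (if x then true else y) ≡ x ∨ y
  eq true  = refl
  eq false = refl

∧P : {A : Set} {i : A → Tree} {x y : A → Bool} →
  Poly i (encodeBool ∘ x) → Poly i (encodeBool ∘ y) → Poly i (λ a → encodeBool (x a ∧ y a))
∧P {x = x} {y} p q = congP (λ a → cong encodeBool (eq (x a))) (ifBoolP {y = λ _ → false} p q nilP)
  where
  eq : ∀ x {y} → (if x then y else false) ≡ x ∧ y
  eq true  = refl
  eq false = refl

notP : {A : Set} {i : A → Tree} {x : A → Bool} →
  Poly i (encodeBool ∘ x) → Poly i (λ a → encodeBool (not (x a)))
notP {x = x} p = congP (λ a → cong encodeBool (eq (x a)))
  (ifBoolP {x = λ _ → false} {λ _ → true} p nilP trueP)
  where
  eq : ∀ x → (if x then false else true) ≡ not x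
  eq true  = refl
  eq false = refl

encRow : List Bool → Tree
encRow = encL encodeBool

encRows : List (List Bool) → Tree
encRows = encL encRow

encBits : List (Bool × Bool) → Tree
encBits = encL (encP encodeBool encodeBool)

size-bool : ∀ b → size (encodeBool b) ≤ 3
size-bool false = s≤s z≤n
size-bool true  = ≤-refl

size-row : ∀ r → size (encRow r) ≤ suc (length r * 4)
size-row []      = ≤-refl
size-row (b ∷ r) = s≤s (≤-trans (+-mono-≤ (size-bool b) (size-row r)) (≤-reflexive (+-suc 3 _)))

orP : {A : Set} {i : A → Tree} {r : A → List Bool} →
  Poly i (λ a → encRow (r a)) → Poly i (λ a → encodeBool (or (r a)))
orP = foldP (λ _ r → encodeBool (or r))
  (Bounded-mono (λ (_ , r) → size-bool (or r)) (Bounded-const 3)) nilP (∨P itemP accP)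

-- The reduction on lists; ᴸ marks the list versions of functions defined on vectors below

Row BitPairs : Set
Row      = List Bool
BitPairs = List (Bool × Bool)

-- For the list of pairs (a , b), the w-th row is a, except that its w-th bit is a ∨ b.
diagonal : BitPairs → List Row
diagonal []            = []
diagonal ((a , b) ∷ v) = ((a ∨ b) ∷ map proj₁ v) ∷ map (a ∷_) (diagonal v)

length-diagonal : ∀ v → length (diagonal v) ≡ length v
length-diagonal []            = refl
length-diagonal ((a , b) ∷ v) =
  cong suc (trans (List.length-map (a ∷_) (diagonal v)) (length-diagonal v))

-- A new pair lengthens every earlier row, so the growth is not controlled by the item alone and
-- `Bounded-additive` does not apply. But a square of bits, each taking at most 4 with its cons
-- node, is quadratic in `length v`.
size-diagonal : ∀ v → size (encRows (diagonal v)) ≤ suc (length v * (9 + length v * 8))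
size-diagonal []                = ≤-refl
size-diagonal (ab@(a , b) ∷ v) = s≤s (begin
  size (encRow ((a ∨ b) ∷ map proj₁ v)) + size (encRows (map (a ∷_) (diagonal v)))
    ≤⟨ +-mono-≤ (size-row ((a ∨ b) ∷ map proj₁ v)) (push (diagonal v)) ⟩
  suc (suc (length (map proj₁ v)) * 4) + (length (diagonal v) * 4 + size (encRows (diagonal v)))
    ≡⟨ cong₂ (λ l l′ → suc (suc l * 4) + (l′ * 4 + size (encRows (diagonal v))))
             (List.length-map proj₁ v) (length-diagonal v) ⟩
  suc (suc (length v) * 4) + (length v * 4 + size (encRows (diagonal v)))
    ≤⟨ +-monoʳ-≤ (suc (suc (length v) * 4)) (+-monoʳ-≤ (length v * 4) (size-diagonal v)) ⟩
  suc (suc (length v) * 4) + (length v * 4 + suc (length v * (9 + length v * 8)))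
    -- The slack that completes the sum to the quadratic bound at `suc (length v)`.
    ≤⟨ m≤m+n _ (11 + length v * 8) ⟩
  suc (suc (length v) * 4) + (length v * 4 + suc (length v * (9 + length v * 8))) + (11 + length v * 8)
    ≡⟨ expand (length v) ⟩
  suc (length v) * (9 + suc (length v) * 8) ∎)
  where
  open ≤-Reasoning
  expand : ∀ l → suc (suc l * 4) + (l * 4 + suc (l * (9 + l * 8))) + (11 + l * 8) ≡
                 suc l * (9 + suc l * 8)
  expand = solve-∀

  push : ∀ rs → size (encRows (map (a ∷_) rs)) ≤ length rs * 4 + size (encRows rs)
  push []       = ≤-refl
  push (r ∷ rs) = ≤-trans (s≤s (+-mono-≤ (s≤s (+-monoˡ-≤ (size (encRow r)) (size-bool a))) (push rs)))
    (≤-reflexive (regroup (size (encRow r)) (length rs * 4) (size (encRows rs))))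
    where
    regroup : ∀ r l s → suc (suc (3 + r) + (l + s)) ≡ 4 + l + suc (r + s)
    regroup = solve-∀

length-bounded : {A X : Set} {i : A → Tree} {enc : X → Tree} {xs : A → List X} →
  Poly i (λ a → encL enc (xs a)) → Bounded i (λ a → length (xs a))
length-bounded {enc = enc} {xs} p =
  Bounded-mono (λ a → ≤-trans (n≤1+n _) (length<size enc (xs a))) (output-bounded p)

diagonalP : {A : Set} {i : A → Tree} {v : A → BitPairs} →
  Poly i (λ a → encBits (v a)) → Poly i (λ a → encRows (diagonal (v a)))
diagonalP {i = i} {v} p = tlP {o = λ a → encRow (map proj₁ (v a))} (foldP out
  (Bounded-mono {b′ = λ (a , v) → suc (suc (length v * 4) + suc (length v * (9 + length v * 8)))}
     (λ (a , v) → s≤s (+-mono-≤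
       (≤-trans (size-row (map proj₁ v))
                (≤-reflexive (cong (λ l → suc (l * 4)) (List.length-map proj₁ v))))
       (size-diagonal v)))
     (Bounded-+ (Bounded-const 2) (Bounded-+ (Bounded-* len (Bounded-const 4))
        (Bounded-+ (Bounded-const 1)
          (Bounded-* len (Bounded-+ (Bounded-const 9) (Bounded-* len (Bounded-const 8))))))))
  (pairP nilP nilP)
  (pairP (pairP (hdP itemP) (hdP accP))
         (pairP (pairP (∨P (hdP itemP) (tlP itemP)) (hdP accP))
                (mapP (pairP (hdP (envP itemP)) (hdP idP)) (tlP accP))))
  p)
  where
  out : _ → BitPairs → Tree
  -- The row of first bits is carried along because the next step places it below its own top bit.
  out _ v = encRow (map proj₁ v) ∙ encRows (diagonal v)
  len : Bounded (λ (a , v) → encBits v ∙ i a) (λ (a , v) → length v)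
  len = length-bounded (hdP idP)

-- The rows of the identity matrix, that is, the singletons, one for each entry of `xs`.
units : {X : Set} → List X → List Row
units xs = diagonal (map (const (false , true)) xs)

unitsP : {A X : Set} {i : A → Tree} {enc : X → Tree} {xs : A → List X} →
  Poly i (λ a → encL enc (xs a)) → Poly i (λ a → encRows (units (xs a)))
unitsP p = diagonalP (mapP (pairP nilP trueP) p)

ruleEdgesᴸ : BitPairs → List Row
ruleEdgesᴸ v = map (map proj₁ v ++_) (diagonal v)

ruleEdgesᴸP : {A : Set} {i : A → Tree} {v : A → BitPairs} →
  Poly i (λ a → encBits (v a)) → Poly i (λ a → encRows (ruleEdgesᴸ (v a)))
ruleEdgesᴸP p = mapP (appendP (envP (mapP (hdP (hdP idP)) p)) (hdP idP)) (diagonalP p)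

rulesᴸ : Row → List Row → List BitPairs
rulesᴸ ns S =
  (map (const (true , true)) ns ++ map (const (false , true)) S)
  ∷ map (λ u → map (_, false) u ++ map (const (false , false)) S) (units ns)
  ++ map (λ (s , u) → map (false ,_) s ++ map (_, false) u) (zipPad [] S (units S))

rulesᴸP : {A : Set} {i : A → Tree} {ns : A → Row} {S : A → List Row} →
  Poly i (λ a → encRow (ns a)) → Poly i (λ a → encRows (S a)) →
  Poly i (λ a → encL encBits (rulesᴸ (ns a) (S a)))
rulesᴸP p q = pairP
  (appendP (mapP (pairP trueP trueP) p) (mapP (pairP nilP trueP) q))
  (appendP
    (mapP (appendP (mapP (pairP (hdP idP) nilP) (hdP idP)) (envP (mapP (pairP nilP nilP) q)))
          (unitsP p))
    (mapP (appendP (mapP (pairP nilP (hdP idP)) (hdP (hdP idP)))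
                   (mapP (pairP (hdP idP) nilP) (tlP (hdP idP))))
          (zipPadP refl q (unitsP q))))

edgesᴸ : Row → List Row → List Row
edgesᴸ ns S = concat (map ruleEdgesᴸ (rulesᴸ ns S))

edgesᴸP : {A : Set} {i : A → Tree} {ns : A → Row} {S : A → List Row} →
  Poly i (λ a → encRow (ns a)) → Poly i (λ a → encRows (S a)) →
  Poly i (λ a → encRows (edgesᴸ (ns a) (S a)))
edgesᴸP p q = concatP (mapP (ruleEdgesᴸP (hdP idP)) (rulesᴸP p q))

blocksᴸ : List Row → List Row
blocksᴸ S = map (λ (s , u) → (s ++ u) ++ (s ++ u)) (zipPad [] S (units S))

blocksᴸP : {A : Set} {i : A → Tree} {S : A → List Row} →
  Poly i (λ a → encRows (S a)) → Poly i (λ a → encRows (blocksᴸ (S a)))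
blocksᴸP q = mapP (appendP su su) (zipPadP refl q (unitsP q))
  where su = appendP (hdP (hdP idP)) (tlP (hdP idP))

selectStep : Row → Row × Row → Row × Row
selectStep d (c , t) =
  map (λ (x , y) → x ∧ not y) (zipPad false c d) ,
  or (map (λ (x , y) → x ∧ y) (zipPad false c d)) ∷ t

selectᴸ : Row → List Row → Row × Row
selectᴸ c = foldr selectStep (c , [])

-- The intermediate results stay small because the remaining row keeps the length of `c` and the
-- selection gains one bit per block.
selectᴸP : {A : Set} {i : A → Tree} {c : A → Row} {D : A → List Row} →
  Poly i (λ a → encRow (c a)) → Poly i (λ a → encRows (D a)) →
  Poly i (λ a → encRow (proj₂ (selectᴸ (c a) (D a))))
selectᴸP {i = i} {c} {D} p q = tlP {o = λ a → encRow (proj₁ (selectᴸ (c a) (D a)))} (foldP out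
  (Bounded-mono {b′ = λ (a , D) → suc (suc (length (c a) * 4) + suc (length D * 4))}
    (λ (a , D) → s≤s (+-mono-≤
      (≤-trans (size-row (proj₁ (selectᴸ (c a) D)))
               (≤-reflexive (cong (λ l → suc (l * 4)) (length₁ (c a) D))))
      (≤-trans (size-row (proj₂ (selectᴸ (c a) D)))
               (≤-reflexive (cong (λ l → suc (l * 4)) (length₂ (c a) D))))))
    (Bounded-+ (Bounded-const 2) (Bounded-+
      (Bounded-* (length-bounded (tlP idP then reindexP proj₁ p)) (Bounded-const 4))
      (Bounded-+ (Bounded-const 1)
        (Bounded-* (length-bounded {enc = encRow} (hdP idP)) (Bounded-const 4))))))
  (pairP p nilP)
  (pairP (mapP (∧P (hdP (hdP idP)) (notP (tlP (hdP idP)))) zipped)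
         (pairP (orP (mapP (∧P (hdP (hdP idP)) (tlP (hdP idP))) zipped)) (tlP accP)))
  q)
  where
  out : _ → List Row → Tree
  out a D = encRow (proj₁ (selectᴸ (c a) D)) ∙ encRow (proj₂ (selectᴸ (c a) D))

  zipped : Poly (λ (a , d , D) → (encRow d ∙ out a D) ∙ i a)
                (λ (a , d , D) → encBits (zipPad false (proj₁ (selectᴸ (c a) D)) d))
  zipped = zipPadP refl (hdP accP) itemP

  length-zipPad : ∀ (c d : Row) → length (zipPad false c d) ≡ length c
  length-zipPad []      d = refl
  length-zipPad (x ∷ c) d = cong suc (length-zipPad c _)

  length₁ : ∀ c D → length (proj₁ (selectᴸ c D)) ≡ length c
  length₁ c []      = refl
  length₁ c (d ∷ D) = trans (List.length-map _ (zipPad false (proj₁ (selectᴸ c D)) d))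
                            (trans (length-zipPad (proj₁ (selectᴸ c D)) d) (length₁ c D))

  length₂ : ∀ c D → length (proj₂ (selectᴸ c D)) ≡ length D
  length₂ c []      = refl
  length₂ c (d ∷ D) = cong suc (length₂ c D)

-- Runs of the loop

same-size⇒⊆ : ∀ {n} (e C : Subset n) → ∣ e ∩ C ∣ ≡ ∣ e ∣ → e ⊆ C
same-size⇒⊆ (false ∷ e) (_     ∷ C) eq (there u∈e) = there (same-size⇒⊆ e C eq u∈e)
same-size⇒⊆ (true  ∷ e) (true  ∷ C) eq here        = here
same-size⇒⊆ (true  ∷ e) (true  ∷ C) eq (there u∈e) = there (same-size⇒⊆ e C (suc-injective eq) u∈e)
same-size⇒⊆ (true  ∷ e) (false ∷ C) eq _           =
  contradiction eq (<⇒≢ (s≤s (∣p∩q∣≤∣p∣ e C)))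

⊆⇒∩≡ : ∀ {n} (e C : Subset n) → e ⊆ C → e ∩ C ≡ e
⊆⇒∩≡ e C e⊆C = ⊆-antisym (proj₁ ∘ x∈p∩q⁻ e C) (λ u∈e → x∈p∩q⁺ (u∈e , e⊆C u∈e))

∩≡⇒⊆ : ∀ {n} (e C : Subset n) → e ∩ C ≡ e → e ⊆ C
∩≡⇒⊆ e C eq u∈e = proj₂ (x∈p∩q⁻ e C (subst (_ ∈_) (sym eq) u∈e))

-- Together with `one-missing⁻` this replaces the counting condition of `activate` by statements
-- about single vertices.
one-missing⁺ : ∀ {n} (e C : Subset n) {u} → u ∈ e → u ∉ C →
  (∀ {v} → v ∈ e → v ≢ u → v ∈ C) → suc ∣ e ∩ C ∣ ≡ ∣ e ∣
one-missing⁺ (true  ∷ e) (true  ∷ C) here u∉C h = contradiction here u∉C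
one-missing⁺ (true  ∷ e) (false ∷ C) here u∉C h =
  cong (suc ∘ ∣_∣) (⊆⇒∩≡ e C λ v∈e → drop-there (h (there v∈e) λ ()))
one-missing⁺ (false ∷ e) (_     ∷ C) (there u∈e) u∉C h =
  one-missing⁺ e C u∈e (u∉C ∘ there)
    λ v∈e v≢u → drop-there (h (there v∈e) (v≢u ∘ Fin.suc-injective))
one-missing⁺ (true  ∷ e) (true  ∷ C) (there u∈e) u∉C h =
  cong suc (one-missing⁺ e C u∈e (u∉C ∘ there)
    λ v∈e v≢u → drop-there (h (there v∈e) (v≢u ∘ Fin.suc-injective)))
one-missing⁺ (true  ∷ e) (false ∷ C) (there u∈e) u∉C h with () ← h here (λ ())

one-missing⁻ : ∀ {n} (e C : Subset n) → suc ∣ e ∩ C ∣ ≡ ∣ e ∣ →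
  ∀ {u v} → u ∈ e → u ∉ C → v ∈ e → v ≢ u → v ∈ C
one-missing⁻ (false ∷ e) (_     ∷ C) eq (there u∈e) u∉C (there v∈e) v≢u =
  there (one-missing⁻ e C eq u∈e (u∉C ∘ there) v∈e (v≢u ∘ cong suc))
one-missing⁻ (true  ∷ e) (true  ∷ C) eq here        u∉C _           v≢u = contradiction here u∉C
one-missing⁻ (true  ∷ e) (true  ∷ C) eq (there u∈e) u∉C here        v≢u = here
one-missing⁻ (true  ∷ e) (true  ∷ C) eq (there u∈e) u∉C (there v∈e) v≢u =
  there (one-missing⁻ e C (suc-injective eq) u∈e (u∉C ∘ there) v∈e (v≢u ∘ cong suc))
one-missing⁻ (true  ∷ e) (false ∷ C) eq here        u∉C here        v≢u = contradiction refl v≢u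
one-missing⁻ (true  ∷ e) (false ∷ C) eq here        u∉C (there v∈e) v≢u =
  there (same-size⇒⊆ e C (suc-injective eq) v∈e)
one-missing⁻ (true  ∷ e) (false ∷ C) eq (there u∈e) u∉C _           v≢u =
  contradiction (there (same-size⇒⊆ e C (suc-injective eq) u∈e)) u∉C

-- The condition for an invariant of runs. `Z` is a predicate and not a `Subset`, since its later
-- instance `Reached` contains the proposition `Covers S T`.
Stable : ∀ {n} → List (Subset n) → (Fin n → Set) → Set
Stable E Z = ∀ {e C} → e ∈ᴸ E → (∀ {u} → u ∈ C → Z u) → suc ∣ e ∩ C ∣ ≡ ∣ e ∣ →
  ∀ {u} → u ∈ e → Z u

Progress : ∀ {n} → List (Subset n) → Subset n → Set
Progress E C = ∀ {u} → u ∉ C → ∃[ e ] e ∈ᴸ E × suc ∣ e ∩ C ∣ ≡ ∣ e ∣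

loop-stable : ∀ {n} (E₀ : List (Subset n)) (Z : Fin n → Set) →
  Stable E₀ Z → ∀ {E C D} → Loop E C D → (∀ {e} → e ∈ᴸ E → e ∈ᴸ E₀) →
  (∀ {u} → u ∈ C → Z u) → ∀ {u} → u ∈ D → Z u
loop-stable E₀ Z stable return-1 E⊆E₀ C⊆Z = C⊆Z
loop-stable E₀ Z stable (activate {C = C} e e∈E one rest) E⊆E₀ C⊆Z =
  loop-stable E₀ Z stable rest (E⊆E₀ ∘ proj₁ ∘ ∈-filter⁻ _)
    ([ C⊆Z , stable (E⊆E₀ e∈E) C⊆Z one ]′ ∘ x∈p∪q⁻ C e)

-- The invariant is that `E` consists of the edges of `E₀` not inside `C`. While a vertex is
-- missing, some edge fires and is then filtered out, so `fuel` need only exceed the number of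
-- edges. Once all vertices are active, no edge can remain and the run returns 1.
loop-complete : ∀ {n} (E₀ : List (Subset n)) (C₀ : Subset n) →
  (∀ C → C₀ ⊆ C → Progress E₀ C) →
  ∀ fuel E C → length E < fuel → C₀ ⊆ C →
  (∀ {e} → e ∈ᴸ E₀ → ¬ e ⊆ C → e ∈ᴸ E) → (∀ {e} → e ∈ᴸ E → ¬ e ⊆ C) →
  ∃[ D ] Loop E C D × D ≡ ⊤
loop-complete E₀ C₀ progress (suc fuel) E C (s≤s E≤) C₀⊆C active nonempty
  with Fin.all? (_∈? C)
... | yes all =
  C , subst (λ E → Loop E C C) (sym (empty E nonempty)) return-1 , ⊆-antisym ⊆⊤ (λ _ → all _)
  where
  empty : ∀ E → (∀ {e} → e ∈ᴸ E → ¬ e ⊆ C) → E ≡ []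
  empty []      _ = refl
  empty (e ∷ E) h = ⊥-elim (h (here refl) (λ _ → all _))
... | no ¬all
  with u , u∉C ← Fin.¬∀⟶∃¬ _ _ (_∈? C) ¬all
  with e , e∈E₀ , one ← progress C C₀⊆C u∉C
  = let D , run , D≡⊤ = loop-complete E₀ C₀ progress fuel (filter P? E) (C ∪ e)
          (<-≤-trans
            (List.filter-notAll P? E (lose e∈E (λ ¬eq → ¬eq (⊆⇒∩≡ e (C ∪ e) (q⊆p∪q C e))))) E≤)
          (p⊆p∪q e ∘ C₀⊆C)
          (λ {e′} e′∈E₀ e′⊈ → ∈-filter⁺ P?
            (active e′∈E₀ (λ e′⊆C → e′⊈ (p⊆p∪q e ∘ e′⊆C))) (e′⊈ ∘ ∩≡⇒⊆ e′ (C ∪ e)))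
          (λ {e′} e′∈ e′⊆ → proj₂ (∈-filter⁻ P? {xs = E} e′∈) (⊆⇒∩≡ e′ (C ∪ e) e′⊆))
    in D , activate e e∈E one run , D≡⊤
  where
  P? = λ e′ → ¬? (≡-dec Bool._≟_ (e′ ∩ (C ∪ e)) e′)
  e∈E : e ∈ᴸ E
  -- An edge with one vertex missing is not inside `C`, so it has not been removed yet.
  e∈E = active e∈E₀ λ e⊆C → 1+n≢n (trans one (sym (cong ∣_∣ (⊆⇒∩≡ e C e⊆C))))

core-stable : (H : Hypergraph) (Z : Fin (Hypergraph.n H) → Set) →
  Stable (Hypergraph.E H) Z → ∀ {C} → IsCore H C → (∀ {u} → u ∈ C → Z u) → ∀ u → Z u
core-stable H Z stable (D , run , refl) C⊆Z u =
  loop-stable (Hypergraph.E H) Z stable run (proj₁ ∘ ∈-filter⁻ _) C⊆Z ∈⊤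

progress⇒core : (H : Hypergraph) (C₀ : Subset (Hypergraph.n H)) →
  (∀ C → C₀ ⊆ C → Progress (Hypergraph.E H) C) → IsCore H C₀
progress⇒core H C₀ progress = loop-complete E C₀ progress _ (filter P? E) C₀ ≤-refl id
  (∈-filter⁺ P?) (λ e∈ → proj₂ (∈-filter⁻ P? {xs = E} e∈))
  where
  open Hypergraph H
  P? = λ e → ¬? (e ⊆? C₀)

-- From rules to edges

left right : ∀ {k} → Fin k → Fin (k + k)
left  {k} i = i ↑ˡ k
right {k} i = k ↑ʳ i

left≢right : ∀ {m n} (i : Fin m) (j : Fin n) → i ↑ˡ n ≢ m ↑ʳ j
left≢right {m} {n} i j eq
  with () ← trans (sym (Fin.splitAt-↑ˡ m i n)) (trans (cong (splitAt m) eq) (Fin.splitAt-↑ʳ m n j))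

data Split (m : ℕ) {n : ℕ} : Fin (m + n) → Set where
  inˡ : ∀ i → Split m (i ↑ˡ n)
  inʳ : ∀ j → Split m (m ↑ʳ j)

split : ∀ m {n} (i : Fin (m + n)) → Split m i
split zero    i       = inʳ i
split (suc m) zero    = inˡ zero
split (suc m) (suc i) with split m i
... | inˡ i = inˡ (suc i)
... | inʳ j = inʳ j

-- Bits (a , b) at i: a says whether i is a premise of the rule, b whether it is a conclusion.
Rule : ℕ → Set
Rule k = Vec (Bool × Bool) k

-- The primed half of an edge. The disjunction adds `w′` only if `w` is a conclusion; otherwise the
-- edge is just the two copies of the premises.
single : ∀ {k} → Rule k → Fin k → Subset k
single v w = Vec.map proj₁ v [ w ]≔ uncurry _∨_ (lookup v w)

edge : ∀ {k} → Rule k → Fin k → Subset (k + k)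
edge v w = Vec.map proj₁ v Vec.++ single v w

Premise Conclusion : ∀ {k} → Rule k → Fin k → Set
Premise    v i = proj₁ (lookup v i) ≡ true
Conclusion v i = proj₂ (lookup v i) ≡ true

module _ {k : ℕ} (v : Rule k) (w : Fin k) where

  lookup-left : ∀ i → lookup (edge v w) (left i) ≡ proj₁ (lookup v i)
  lookup-left i = trans (lookup-++ˡ (Vec.map proj₁ v) _ i) (lookup-map i proj₁ v)

  lookup-right : ∀ i → lookup (edge v w) (right i) ≡ lookup (single v w) i
  lookup-right i = lookup-++ʳ (Vec.map proj₁ v) (single v w) i

  left∈edge⁺ : ∀ {i} → Premise v i → left i ∈ edge v w
  left∈edge⁺ {i} a = lookup⇒[]= _ _ (trans (lookup-left i) a)

  left∈edge⁻ : ∀ {i} → left i ∈ edge v w → Premise v i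
  left∈edge⁻ {i} h = trans (sym (lookup-left i)) ([]=⇒lookup h)

  lookup-target : lookup (edge v w) (right w) ≡ proj₁ (lookup v w) ∨ proj₂ (lookup v w)
  lookup-target = trans (lookup-right w) (lookup∘update w (Vec.map proj₁ v) _)

  lookup-other : ∀ {i} → i ≢ w → lookup (edge v w) (right i) ≡ proj₁ (lookup v i)
  lookup-other {i} i≢w = trans (lookup-right i)
    (trans (lookup∘update′ i≢w (Vec.map proj₁ v) _) (lookup-map i proj₁ v))

  right∈edge⁺ : ∀ {i} → Premise v i → right i ∈ edge v w
  right∈edge⁺ {i} a with i Fin.≟ w
  ... | yes refl = lookup⇒[]= _ _ (trans lookup-target (cong (_∨ proj₂ (lookup v i)) a))
  ... | no i≢w   = lookup⇒[]= _ _ (trans (lookup-other i≢w) a)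

  target∈edge : Conclusion v w → right w ∈ edge v w
  target∈edge b = lookup⇒[]= _ _
    (trans lookup-target (trans (cong (proj₁ (lookup v w) ∨_) b) (Bool.∨-zeroʳ _)))

  right∈edge⁻ : ∀ {i} → right i ∈ edge v w → Premise v i ⊎ (i ≡ w × Conclusion v w)
  right∈edge⁻ {i} h with i Fin.≟ w
  ... | no i≢w   = inj₁ (trans (sym (lookup-other i≢w)) ([]=⇒lookup h))
  ... | yes refl with proj₁ (lookup v w) in eq | trans (sym lookup-target) ([]=⇒lookup h)
  ...   | true  | _ = inj₁ refl
  ...   | false | b = inj₂ (refl , b)

  -- If the missing vertex is a copy of a premise, the other copy is in the edge and hence in `C`,
  -- so closure of `Z` under exchanging copies applies. If it is the target, all premises are in `C`
  -- and the rule applies.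
  rule-sound : (Z : Fin (k + k) → Set) →
    (∀ {i} → Z (left i) → Z (right i)) → (∀ {i} → Z (right i) → Z (left i)) →
    ((∀ {i} → Premise v i → Z (left i)) → Conclusion v w → Z (right w)) →
    ∀ {C} → (∀ {u} → u ∈ C → Z u) → suc ∣ edge v w ∩ C ∣ ≡ ∣ edge v w ∣ →
    ∀ {u} → u ∈ edge v w → Z u
  rule-sound Z l⇒r r⇒l rule {C} C⊆Z one {u} u∈e with u ∈? C
  ... | yes u∈C = C⊆Z u∈C
  ... | no  u∉C with split k u
  ...   | inˡ i = r⇒l {i} (C⊆Z (one-missing⁻ (edge v w) C one u∈e u∉C
                    (right∈edge⁺ (left∈edge⁻ u∈e)) (left≢right i i ∘ sym)))
  ...   | inʳ i with right∈edge⁻ u∈e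
  ...     | inj₁ a = l⇒r {i} (C⊆Z
              (one-missing⁻ (edge v w) C one u∈e u∉C (left∈edge⁺ a) (left≢right i i)))
  ...     | inj₂ (refl , b) = rule
              (λ {j} a → C⊆Z (one-missing⁻ (edge v w) C one u∈e u∉C (left∈edge⁺ a) (left≢right j w))) b

  rule-fires : ∀ C → (∀ {i} → Premise v i → left i ∈ C × right i ∈ C) → Conclusion v w →
    right w ∉ C → suc ∣ edge v w ∩ C ∣ ≡ ∣ edge v w ∣
  rule-fires C premises b w∉C = one-missing⁺ (edge v w) C (target∈edge b) w∉C rest
    where
    rest : ∀ {u} → u ∈ edge v w → u ≢ right w → u ∈ C
    rest {u} u∈e u≢w with split k u
    ... | inˡ i = proj₁ (premises (left∈edge⁻ u∈e))
    ... | inʳ i with right∈edge⁻ u∈e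
    ...   | inj₁ a          = proj₂ (premises a)
    ...   | inj₂ (refl , _) = contradiction refl u≢w

  -- Here the edge consists of the two copies of w.
  twin-fires : ∀ C → Premise v w → proj₂ (lookup v w) ≡ false → (∀ {i} → Premise v i → i ≡ w) →
    lookup C (left w) ≢ lookup C (right w) → suc ∣ edge v w ∩ C ∣ ≡ ∣ edge v w ∣
  twin-fires C a ¬b unique differ with left w ∈? C | right w ∈? C
  ... | yes l | yes r = contradiction (trans ([]=⇒lookup l) (sym ([]=⇒lookup r))) differ
  ... | no ¬l | yes r = one-missing⁺ (edge v w) C (left∈edge⁺ a) ¬l rest
    where
    rest : ∀ {u} → u ∈ edge v w → u ≢ left w → u ∈ C
    rest {u} u∈e u≢w with split k u
    ... | inˡ i = contradiction (cong left (unique (left∈edge⁻ u∈e))) u≢w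
    ... | inʳ i with right∈edge⁻ u∈e
    ...   | inj₁ p          = subst (λ i → right i ∈ C) (sym (unique p)) r
    ...   | inj₂ (refl , _) = r
  ... | yes l | no ¬r = one-missing⁺ (edge v w) C (right∈edge⁺ a) ¬r rest
    where
    rest : ∀ {u} → u ∈ edge v w → u ≢ right w → u ∈ C
    rest {u} u∈e u≢w with split k u
    ... | inˡ i = subst (λ i → left i ∈ C) (sym (unique (left∈edge⁻ u∈e))) l
    ... | inʳ i with right∈edge⁻ u∈e
    ...   | inj₁ p          = contradiction (cong right (unique p)) u≢w
    ...   | inj₂ (refl , _) = contradiction refl u≢w
  ... | no ¬l | no ¬r = contradiction (trans (∉⇒false ¬l) (sym (∉⇒false ¬r))) differ
    where
    ∉⇒false : ∀ {i} → i ∉ C → lookup C i ≡ false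
    ∉⇒false {i} i∉C with lookup C i in eq
    ... | true  = contradiction (lookup⇒[]= i C eq) i∉C
    ... | false = refl

-- The reduction

-- The sets outside a cover have to be activated too; this rule does it once all elements are
-- active.
ruleAll : ∀ n m → Rule (n + m)
ruleAll n m = replicate n (true , true) Vec.++ replicate m (false , true)

-- Without conclusion, hence present only for the edge joining the two copies of an element.
ruleElement : ∀ {n} m → Fin n → Rule (n + m)
ruleElement m j = Vec.map (_, false) ⁅ j ⁆ Vec.++ replicate m (false , false)

-- For `w = set k` the edge consists of the two copies of the set `k`, so this rule also joins those
-- copies.
ruleSet : ∀ {n m} → Vec (Subset n) m → Fin m → Rule (n + m)
ruleSet S k = Vec.map (false ,_) (lookup S k) Vec.++ Vec.map (_, false) ⁅ k ⁆

rules : ∀ {n m} → Vec (Subset n) m → List (Rule (n + m))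
rules {n} {m} S = ruleAll n m ∷ tabulate (ruleElement m) ++ tabulate (ruleSet S)

edges : ∀ {n m} → Vec (Subset n) m → List (Subset ((n + m) + (n + m)))
edges S = concatMap (λ v → tabulate (edge v)) (rules S)

half : ∀ {n m} → Vec (Subset n) m → Fin m → Subset (n + m)
half S k = lookup S k Vec.++ ⁅ k ⁆

-- Everything that the set `k` activates without the help of `ruleAll`.
block : ∀ {n m} → Vec (Subset n) m → Fin m → Subset ((n + m) + (n + m))
block S k = half S k Vec.++ half S k

module _ {n m : ℕ} (S : Vec (Subset n) m) where

  element : Fin n → Fin (n + m)
  element j = j ↑ˡ m

  set : Fin m → Fin (n + m)
  set k = n ↑ʳ k

  edge∈ : ∀ {v} → v ∈ᴸ rules S → ∀ w → edge v w ∈ᴸ edges S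
  edge∈ v∈ w = ∈-concatMap⁺ _ (lose v∈ (∈-tabulate⁺ w))

  ruleElement∈ : ∀ j → ruleElement m j ∈ᴸ rules S
  ruleElement∈ j = there (∈-++⁺ˡ (∈-tabulate⁺ j))

  ruleSet∈ : ∀ k → ruleSet S k ∈ᴸ rules S
  ruleSet∈ k = there (∈-++⁺ʳ _ (∈-tabulate⁺ k))

  ruleAll-element : ∀ j → lookup (ruleAll n m) (element j) ≡ (true , true)
  ruleAll-element j = trans (lookup-++ˡ (replicate n (true , true)) _ j) (lookup-replicate j _)

  ruleAll-set : ∀ k → lookup (ruleAll n m) (set k) ≡ (false , true)
  ruleAll-set k = trans (lookup-++ʳ (replicate n _) _ k) (lookup-replicate k _)

  ruleElement-element : ∀ j i → lookup (ruleElement m j) (element i) ≡ (lookup ⁅ j ⁆ i , false)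
  ruleElement-element j i =
    trans (lookup-++ˡ (Vec.map (_, false) ⁅ j ⁆) _ i) (lookup-map i (_, false) ⁅ j ⁆)

  ruleElement-set : ∀ j k → lookup (ruleElement m j) (set k) ≡ (false , false)
  ruleElement-set j k = trans (lookup-++ʳ (Vec.map _ ⁅ j ⁆) _ k) (lookup-replicate k _)

  ruleSet-element : ∀ k j → lookup (ruleSet S k) (element j) ≡ (false , lookup (lookup S k) j)
  ruleSet-element k j =
    trans (lookup-++ˡ (Vec.map (false ,_) (lookup S k)) _ j) (lookup-map j (false ,_) (lookup S k))

  ruleSet-set : ∀ k l → lookup (ruleSet S k) (set l) ≡ (lookup ⁅ k ⁆ l , false)
  ruleSet-set k l = trans (lookup-++ʳ (Vec.map _ (lookup S k)) _ l) (lookup-map l _ ⁅ k ⁆)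

  ∈⁅⁆ : ∀ {k} (i : Fin k) → lookup ⁅ i ⁆ i ≡ true
  ∈⁅⁆ i = []=⇒lookup (x∈⁅x⁆ i)

  ∈⁅⁆⁻ : ∀ {k} {i j : Fin k} → lookup ⁅ i ⁆ j ≡ true → j ≡ i
  ∈⁅⁆⁻ {i = i} {j} eq = x∈⁅y⁆⇒x≡y i (lookup⇒[]= j ⁅ i ⁆ eq)

  ruleAll-premise : ∀ {i} → Premise (ruleAll n m) i → ∃[ j ] i ≡ element j
  ruleAll-premise {i} a with split n i
  ... | inˡ j = j , refl
  ... | inʳ k with () ← trans (sym (cong proj₁ (ruleAll-set k))) a

  ruleElement-premise : ∀ j {i} → Premise (ruleElement m j) i → i ≡ element j
  ruleElement-premise j {i} a with split n i
  ... | inˡ l = cong element (∈⁅⁆⁻ (trans (sym (cong proj₁ (ruleElement-element j l))) a))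
  ... | inʳ k with () ← trans (sym (cong proj₁ (ruleElement-set j k))) a

  ruleSet-premise : ∀ k {i} → Premise (ruleSet S k) i → i ≡ set k
  ruleSet-premise k {i} a with split n i
  ... | inˡ j with () ← trans (sym (cong proj₁ (ruleSet-element k j))) a
  ... | inʳ l = cong set (∈⁅⁆⁻ (trans (sym (cong proj₁ (ruleSet-set k l))) a))

  ruleElement-conclusion : ∀ j i → proj₂ (lookup (ruleElement m j) i) ≡ false
  ruleElement-conclusion j i with split n i
  ... | inˡ l = cong proj₂ (ruleElement-element j l)
  ... | inʳ k = cong proj₂ (ruleElement-set j k)

  ruleSet-conclusion : ∀ k {i} → Conclusion (ruleSet S k) i → ∃[ j ] i ≡ element j × j ∈ lookup S k
  ruleSet-conclusion k {i} b with split n i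
  ... | inˡ j = j , refl , lookup⇒[]= _ _ (trans (sym (cong proj₂ (ruleSet-element k j))) b)
  ... | inʳ l with () ← trans (sym (cong proj₂ (ruleSet-set k l))) b

  same? : ∀ (C : Subset ((n + m) + (n + m))) w →
    Dec (lookup C (left {n + m} w) ≡ lookup C (right w))
  same? C w = lookup C (left w) Bool.≟ lookup C (right w)

  twin-edge : ∀ C w → lookup C (left w) ≢ lookup C (right w) →
    ∃[ e ] e ∈ᴸ edges S × suc ∣ e ∩ C ∣ ≡ ∣ e ∣
  twin-edge C w differ with split n w
  ... | inˡ j = edge (ruleElement m j) (element j) , edge∈ (ruleElement∈ j) _ ,
    twin-fires (ruleElement m j) (element j) C
      (trans (cong proj₁ (ruleElement-element j j)) (∈⁅⁆ j)) (ruleElement-conclusion j _)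
      (ruleElement-premise j) differ
  ... | inʳ k = edge (ruleSet S k) (set k) , edge∈ (ruleSet∈ k) _ ,
    twin-fires (ruleSet S k) (set k) C
      (trans (cong proj₁ (ruleSet-set k k)) (∈⁅⁆ k)) (cong proj₂ (ruleSet-set k k))
      (ruleSet-premise k) differ

  module _ {T : Subset m} (covers : Covers S T) where

    -- If the copies of some vertex differ, the edge joining them fires. Otherwise the copies agree,
    -- and either some element is missing or all elements are present and some set is missing.
    progress : ∀ C → (∀ {k} → k ∈ T → left (set k) ∈ C) → Progress (edges S) C
    progress C T⊆C {u} u∉C with Fin.all? (same? C)
    ... | no differ = let w , differ-w = Fin.¬∀⟶∃¬ _ _ (same? C) differ in twin-edge C w differ-w
    ... | yes same = step
      where
      l⇒r : ∀ {w} → left w ∈ C → right w ∈ C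
      l⇒r {w} h = lookup⇒[]= _ C (trans (sym (same w)) ([]=⇒lookup h))
      r⇒l : ∀ {w} → right w ∈ C → left w ∈ C
      r⇒l {w} h = lookup⇒[]= _ C (trans (same w) ([]=⇒lookup h))

      missing : ∃[ w ] right w ∉ C
      missing with split (n + m) u
      ... | inˡ w = w , u∉C ∘ r⇒l
      ... | inʳ w = w , u∉C

      step : ∃[ e ] e ∈ᴸ edges S × suc ∣ e ∩ C ∣ ≡ ∣ e ∣
      step with Fin.all? (λ j → right (element j) ∈? C)
      -- A missing element is activated by a set of the cover that contains it.
      ... | no ¬all
          with j , j∉C ← Fin.¬∀⟶∃¬ _ _ (λ j → right (element j) ∈? C) ¬all
          with k , k∈T , j∈S ← covers j
          = edge (ruleSet S k) (element j) , edge∈ (ruleSet∈ k) _ ,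
            rule-fires (ruleSet S k) (element j) C
              (λ a → subst (λ i → left i ∈ C × right i ∈ C) (sym (ruleSet-premise k a))
                       (T⊆C k∈T , l⇒r (T⊆C k∈T)))
              (trans (cong proj₂ (ruleSet-element k j)) ([]=⇒lookup j∈S)) j∉C
      -- With all elements present the missing vertex is a set, and `ruleAll` fires for it.
      ... | yes all with w , w∉C ← missing with split n w
      ...   | inˡ j = contradiction (all j) w∉C
      ...   | inʳ k = edge (ruleAll n m) (set k) , edge∈ (here refl) _ ,
            rule-fires (ruleAll n m) (set k) C
              (λ a → let j , eq = ruleAll-premise a in
                 subst (λ i → left i ∈ C × right i ∈ C) (sym eq) (r⇒l (all j) , all j))
              (cong proj₂ (ruleAll-set k)) w∉C

  element∈half : ∀ {k j} → j ∈ lookup S k → element j ∈ half S k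
  element∈half {k} {j} h = lookup⇒[]= _ _ (trans (lookup-++ˡ (lookup S k) ⁅ k ⁆ j) ([]=⇒lookup h))

  element∈half⁻ : ∀ {k j} → element j ∈ half S k → j ∈ lookup S k
  element∈half⁻ {k} {j} h =
    lookup⇒[]= _ _ (trans (sym (lookup-++ˡ (lookup S k) ⁅ k ⁆ j)) ([]=⇒lookup h))

  set∈half : ∀ {k} → set k ∈ half S k
  set∈half {k} = lookup⇒[]= _ _ (trans (lookup-++ʳ (lookup S k) ⁅ k ⁆ k) (∈⁅⁆ k))

  set∈half⁻ : ∀ {k l} → set l ∈ half S k → l ≡ k
  set∈half⁻ {k} {l} h = ∈⁅⁆⁻ (trans (sym (lookup-++ʳ (lookup S k) ⁅ k ⁆ l)) ([]=⇒lookup h))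

  left∈block : ∀ {k w} → w ∈ half S k → left w ∈ block S k
  left∈block {k} {w} h =
    lookup⇒[]= _ _ (trans (lookup-++ˡ (half S k) (half S k) w) ([]=⇒lookup h))

  left∈block⁻ : ∀ {k w} → left w ∈ block S k → w ∈ half S k
  left∈block⁻ {k} {w} h =
    lookup⇒[]= _ _ (trans (sym (lookup-++ˡ (half S k) (half S k) w)) ([]=⇒lookup h))

  right∈block : ∀ {k w} → w ∈ half S k → right w ∈ block S k
  right∈block {k} {w} h =
    lookup⇒[]= _ _ (trans (lookup-++ʳ (half S k) (half S k) w) ([]=⇒lookup h))

  right∈block⁻ : ∀ {k w} → right w ∈ block S k → w ∈ half S k
  right∈block⁻ {k} {w} h =
    lookup⇒[]= _ _ (trans (sym (lookup-++ʳ (half S k) (half S k) w)) ([]=⇒lookup h))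

  -- An element lies in the block of any set containing it, and the system covers all elements.
  -- Hence discarding all blocks will leave nothing of a core.
  block-covers : Covers S ⊤ → ∀ u → ∃[ k ] u ∈ block S k
  block-covers covering u with split (n + m) u
  block-covers covering _ | inˡ w with split n w
  ... | inˡ j = let k , _ , j∈ = covering j in k , left∈block (element∈half j∈)
  ... | inʳ k = k , left∈block set∈half
  block-covers covering _ | inʳ w with split n w
  ... | inˡ j = let k , _ , j∈ = covering j in k , right∈block (element∈half j∈)
  ... | inʳ k = k , right∈block set∈half

  graph : Hypergraph
  graph = record { n = (n + m) + (n + m) ; E = edges S }

  -- Only one copy of each chosen set is taken, as the edge joining the copies activates the other;
  -- so the core is exactly as large as `T`.
  cover⇒core : ∀ {T} → Covers S T → IsCore graph ((⊥ {n} Vec.++ T) Vec.++ ⊥ {n + m})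
  cover⇒core {T} covers = progress⇒core graph _ λ C C₀⊆C → progress covers C λ {k} k∈T →
    C₀⊆C (lookup⇒[]= (left (set k)) _ (trans (lookup-++ˡ (⊥ {n} Vec.++ T) ⊥ (set k))
      (trans (lookup-++ʳ (⊥ {n}) T k) ([]=⇒lookup k∈T))))

  module _ {T : Subset m} where

    -- The first alternative makes the rule that concludes everything from all elements harmless.
    Reached : Fin ((n + m) + (n + m)) → Set
    Reached u = Covers S T ⊎ (∃[ k ] k ∈ T × u ∈ block S k)

    l⇒r : ∀ {i} → Reached (left i) → Reached (right i)
    l⇒r     (inj₁ c)           = inj₁ c
    l⇒r {i} (inj₂ (k , k∈ , h)) = inj₂ (k , k∈ , right∈block {w = i} (left∈block⁻ h))

    r⇒l : ∀ {i} → Reached (right i) → Reached (left i)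
    r⇒l     (inj₁ c)           = inj₁ c
    r⇒l {i} (inj₂ (k , k∈ , h)) = inj₂ (k , k∈ , left∈block {w = i} (right∈block⁻ h))

    reached-elements : (∀ j → Reached (left (element j))) → Covers S T
    reached-elements h j with h j
    ... | inj₁ c            = c j
    ... | inj₂ (k , k∈ , b) = k , k∈ , element∈half⁻ (left∈block⁻ {w = element j} b)

    -- If all elements are reached, then `T` covers, which is the first alternative of `Reached`.
    -- The rules of elements conclude nothing. The rule of a set `k` is applied only if `k` is
    -- reached, so either `T` covers already or `k` belongs to `T`.
    rules-closed : ∀ {v} → v ∈ᴸ rules S → ∀ w →
      (∀ {i} → Premise v i → Reached (left i)) → Conclusion v w → Reached (right w)
    rules-closed (here refl) w premises _ =
      inj₁ (reached-elements λ j → premises (cong proj₁ (ruleAll-element j)))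
    rules-closed (there v∈) w premises b with ∈-++⁻ (tabulate (ruleElement m)) v∈
    ... | inj₁ v∈₁ with j , refl ← ∈-tabulate⁻ v∈₁
                   with () ← trans (sym b) (ruleElement-conclusion j w)
    ... | inj₂ v∈₂ with k , refl ← ∈-tabulate⁻ v∈₂
                   with j , refl , j∈S ← ruleSet-conclusion k b
                   with premises (trans (cong proj₁ (ruleSet-set k k)) (∈⁅⁆ k))
    ... | inj₁ c = inj₁ c
    -- A block contains the copies of only one set, so `l` is `k`.
    ... | inj₂ (l , l∈T , h) with refl ← set∈half⁻ (left∈block⁻ {w = set k} h) =
          inj₂ (k , l∈T , right∈block (element∈half j∈S))

    -- `Reached` is stable and contains the core, hence every vertex; at the elements this says that
    -- `T` covers.
    core⇒cover : ∀ {C} → IsCore graph C → (∀ {u} → u ∈ C → ∃[ k ] k ∈ T × u ∈ block S k) →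
      Covers S T
    core⇒cover core C⊆ = reached-elements λ j →
      core-stable graph Reached stable core (inj₂ ∘ C⊆) (left (element j))
      where
      stable : Stable (edges S) Reached
      stable e∈ C⊆Z one u∈e
        with v , v∈ , e∈v ← find (∈-concatMap⁻ (λ v → tabulate (edge v)) {xs = rules S} e∈)
        with w , refl ← ∈-tabulate⁻ e∈v
        = rule-sound v w Reached (λ {i} → l⇒r {i}) (λ {i} → r⇒l {i}) (rules-closed v∈ w) C⊆Z one u∈e

-- Greedy selection of a cover from a core

_∖_ : ∀ {k} → Subset k → Subset k → Subset k
_∖_ = Vec.zipWith (λ x y → x ∧ not y)

meets : ∀ {k} → Subset k → Subset k → Bool
meets p q = or (toList (Vec.zipWith _∧_ p q))

select : ∀ {k m} → Subset k → Vec (Subset k) m → Subset k × Subset m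
select C []      = C , []
select C (D ∷ Ds) =
  let rest , T = select C Ds
  in rest ∖ D , meets rest D ∷ T

∈∖⁻ : ∀ {k} {p q : Subset k} {u} → u ∈ p ∖ q → u ∈ p × u ∉ q
∈∖⁻ {p = true  ∷ p} {false ∷ q} here = here , λ ()
∈∖⁻ {p = _     ∷ p} {_     ∷ q} (there h) =
  let u∈p , u∉q = ∈∖⁻ h in there u∈p , u∉q ∘ drop-there

∈∖⁺ : ∀ {k} {p q : Subset k} {u} → u ∈ p → u ∉ q → u ∈ p ∖ q
∈∖⁺ {q = true  ∷ q} here      u∉q = contradiction here u∉q
∈∖⁺ {q = false ∷ q} here      u∉q = here
∈∖⁺ {q = _     ∷ q} (there h) u∉q = there (∈∖⁺ h (u∉q ∘ there))

∈⇒meets : ∀ {k} {p q : Subset k} {u} → u ∈ p → u ∈ q → meets p q ≡ true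
∈⇒meets here      here      = refl
∈⇒meets {p = x ∷ p} {y ∷ q} (there h) (there h′) =
  trans (cong (x ∧ y ∨_) (∈⇒meets h h′)) (Bool.∨-zeroʳ _)

select-disjoint : ∀ {k m} (C : Subset k) (Ds : Vec (Subset k) m) {u} →
  u ∈ proj₁ (select C Ds) → ∀ i → u ∉ lookup Ds i
select-disjoint C (D ∷ Ds) h zero    = proj₂ (∈∖⁻ {p = proj₁ (select C Ds)} h)
select-disjoint C (D ∷ Ds) h (suc i) = select-disjoint C Ds (proj₁ (∈∖⁻ {q = D} h)) i

-- A vertex leaves the remainder only through a block that meets the remainder there, and such a
-- block is selected.
select-covers : ∀ {k m} (C : Subset k) (Ds : Vec (Subset k) m) {u} → u ∈ C →
  u ∈ proj₁ (select C Ds) ⊎ (∃[ i ] i ∈ proj₂ (select C Ds) × u ∈ lookup Ds i)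
select-covers C []       u∈C = inj₁ u∈C
select-covers C (D ∷ Ds) {u} u∈C with select-covers C Ds u∈C
... | inj₂ (i , i∈ , h) = inj₂ (suc i , there i∈ , h)
... | inj₁ h with u ∈? D
...   | yes u∈D = inj₂ (zero , lookup⇒[]= zero (meets (proj₁ (select C Ds)) D ∷ _) (∈⇒meets h u∈D) ,
                          u∈D)
...   | no  u∉D = inj₁ (∈∖⁺ h u∉D)

∣∖∣ : ∀ {k} (p q : Subset k) → ∣ p ∖ q ∣ ≤ ∣ p ∣
∣∖∣ []          []          = z≤n
∣∖∣ (false ∷ p) (_     ∷ q) = ∣∖∣ p q
∣∖∣ (true  ∷ p) (true  ∷ q) = m≤n⇒m≤1+n (∣∖∣ p q)
∣∖∣ (true  ∷ p) (false ∷ q) = s≤s (∣∖∣ p q)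

∣∖∣< : ∀ {k} (p q : Subset k) → meets p q ≡ true → ∣ p ∖ q ∣ < ∣ p ∣
∣∖∣< []          []          ()
∣∖∣< (false ∷ p) (_     ∷ q) h = ∣∖∣< p q h
∣∖∣< (true  ∷ p) (true  ∷ q) h = s≤s (∣∖∣ p q)
∣∖∣< (true  ∷ p) (false ∷ q) h = s≤s (∣∖∣< p q h)

-- The sum of remainder and selection never grows: a selected block removes at least one vertex from
-- the remainder.
select-size : ∀ {k m} (C : Subset k) (Ds : Vec (Subset k) m) →
  ∣ proj₁ (select C Ds) ∣ + ∣ proj₂ (select C Ds) ∣ ≤ ∣ C ∣
select-size C []       = ≤-reflexive (+-identityʳ _)
select-size C (D ∷ Ds) with meets (proj₁ (select C Ds)) D in eq
... | true  = ≤-trans (≤-reflexive (+-suc _ _))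
                (≤-trans (+-monoˡ-≤ _ (∣∖∣< (proj₁ (select C Ds)) D eq)) (select-size C Ds))
... | false = ≤-trans (+-monoˡ-≤ _ (∣∖∣ (proj₁ (select C Ds)) D)) (select-size C Ds)

∣++∣ : ∀ {k l} (p : Subset k) (q : Subset l) → ∣ p Vec.++ q ∣ ≡ ∣ p ∣ + ∣ q ∣
∣++∣ []          q = refl
∣++∣ (true  ∷ p) q = cong suc (∣++∣ p q)
∣++∣ (false ∷ p) q = ∣++∣ p q

blocks : ∀ {n m} → Vec (Subset n) m → Vec (Subset ((n + m) + (n + m))) m
blocks S = Vec.tabulate (block S)

-- The two translations and their costs

reduce : SetSystem → Hypergraph
reduce I = graph (SetSystem.S I)

lift : ∀ I → ∃ (IsCore (reduce I)) → ∃ (Covers (SetSystem.S I))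
lift I (C , core) = proj₂ (select C (blocks S)) , core⇒cover S core selected
  where
  open SetSystem I
  selected : ∀ {u} → u ∈ C → ∃[ k ] k ∈ proj₂ (select C (blocks S)) × u ∈ block S k
  selected {u} u∈C with select-covers C (blocks S) u∈C
  ... | inj₂ (k , k∈T , h) = k , k∈T , subst (u ∈_) (lookup∘tabulate (block S) k) h
  -- A vertex left over would avoid every block, but the blocks exhaust all vertices.
  ... | inj₁ h = let k , u∈block = block-covers S covering u in
    contradiction (subst (u ∈_) (sym (lookup∘tabulate (block S) k)) u∈block)
                  (select-disjoint C (blocks S) h k)

lift-cost : ∀ I s → ∣ proj₁ (lift I s) ∣ ≤ ∣ proj₁ s ∣
lift-cost I (C , _) = ≤-trans (m≤n+m _ _) (select-size C (blocks (SetSystem.S I)))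

open MinProblem using (IsOPT; encodeInstance)

-- `lift` turns an optimal core into a cover that is no larger, and `cover⇒core` turns an optimal
-- cover into a core of equal size.
opt-preserved : ∀ I {opt opt′} → IsOPT SetCover I opt → IsOPT MinCore (reduce I) opt′ →
  opt ≡ opt′
opt-preserved I (((T , covers) , refl) , T-least) ((s , refl) , s-least) = ≤-antisym
  (≤-trans (T-least (lift I s)) (lift-cost I s))
  (≤-trans (s-least (_ , cover⇒core S covers)) (≤-reflexive size-core))
  where
  open SetSystem I
  size-core : ∣ (⊥ {n} Vec.++ T) Vec.++ ⊥ {n + m} ∣ ≡ ∣ T ∣
  size-core = trans (∣++∣ (⊥ {n} Vec.++ T) ⊥) (trans
    (cong₂ _+_ (trans (∣++∣ (⊥ {n}) T) (cong (_+ ∣ T ∣) (∣⊥∣≡0 n))) (∣⊥∣≡0 (n + m)))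
    (+-identityʳ _))

-- No cost is below the common optimum, so both distances are plain differences and `lift-cost`
-- compares them.
error-preserved : ∀ I {opt opt′} → IsOPT SetCover I opt → IsOPT MinCore (reduce I) opt′ →
  ∀ s → ∣ ∣ proj₁ (lift I s) ∣ - opt ∣ ≤ ∣ ∣ proj₁ s ∣ - opt′ ∣
error-preserved I {opt} O O′ s with refl ← opt-preserved I O O′ =
  subst₂ _≤_ (sym (m≤n⇒∣n-m∣≡n∸m (proj₂ O (lift I s))))
             (sym (m≤n⇒∣n-m∣≡n∸m (proj₂ O′ s)))
             (∸-monoˡ-≤ opt (lift-cost I s))

-- Comparison of lists and vectors

toList-tabulate : ∀ {A : Set} {k} (f : Fin k → A) → toList (Vec.tabulate f) ≡ tabulate f
toList-tabulate {k = zero}  f = refl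
toList-tabulate {k = suc k} f = cong (f zero ∷_) (toList-tabulate (f ∘ suc))

toList≡tabulate : ∀ {A : Set} {k} (xs : Vec A k) → toList xs ≡ tabulate (lookup xs)
toList≡tabulate []       = refl
toList≡tabulate (x ∷ xs) = cong (x ∷_) (toList≡tabulate xs)

map-const-toList : ∀ {A B : Set} {k} (y : B) (xs : Vec A k) →
  map (const y) (toList xs) ≡ toList (replicate k y)
map-const-toList y []       = refl
map-const-toList y (x ∷ xs) = cong (y ∷_) (map-const-toList y xs)

toList-replicate-+ : ∀ {A : Set} m n (x : A) →
  toList (replicate m x) ++ toList (replicate n x) ≡ toList (replicate (m + n) x)
toList-replicate-+ zero    n x = refl
toList-replicate-+ (suc m) n x = cong (x ∷_) (toList-replicate-+ m n x)

diagonal-toList : ∀ {k} (v : Rule k) → diagonal (toList v) ≡ tabulate (toList ∘ single v)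
diagonal-toList []            = refl
diagonal-toList ((a , b) ∷ v) = cong₂ _∷_ (cong ((a ∨ b) ∷_) (sym (toList-map proj₁ v)))
  (trans (cong (map (a ∷_)) (diagonal-toList v)) (List.map-tabulate (toList ∘ single v) (a ∷_)))

ruleEdges-toList : ∀ {k} (v : Rule k) → ruleEdgesᴸ (toList v) ≡ tabulate (toList ∘ edge v)
ruleEdges-toList v = trans (cong (map (map proj₁ (toList v) ++_)) (diagonal-toList v))
  (trans (List.map-tabulate (toList ∘ single v) (map proj₁ (toList v) ++_))
    (List.tabulate-cong λ w → trans (cong (_++ toList (single v w)) (sym (toList-map proj₁ v)))
                                    (sym (toList-++ (Vec.map proj₁ v) (single v w)))))

single-replicate : ∀ {k} (i : Fin k) → single (replicate k (false , true)) i ≡ ⁅ i ⁆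
single-replicate {suc k} zero    = cong (true ∷_) (map-replicate proj₁ (false , true) k)
single-replicate {suc k} (suc i) = cong (false ∷_) (single-replicate i)

units-toList : ∀ {A : Set} {k} (xs : Vec A k) →
  units (toList xs) ≡ tabulate (λ (i : Fin k) → toList ⁅ i ⁆)
units-toList {k = k} xs = trans (cong diagonal (map-const-toList (false , true) xs))
  (trans (diagonal-toList (replicate k (false , true)))
    (List.tabulate-cong (cong toList ∘ single-replicate)))

zipPad-tabulate : ∀ {A B : Set} {k} (d : B) (f : Fin k → A) (g : Fin k → B) →
  zipPad d (tabulate f) (tabulate g) ≡ tabulate (λ i → f i , g i)
zipPad-tabulate {k = zero}  d f g = refl
zipPad-tabulate {k = suc k} d f g =
  cong ((f zero , g zero) ∷_) (zipPad-tabulate d (f ∘ suc) (g ∘ suc))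

rows : ∀ {n m} → Vec (Subset n) m → List Row
rows S = toList (Vec.map toList S)

falses : ℕ → Row
falses n = toList (replicate n false)

zip-rows-units : ∀ {n m} (S : Vec (Subset n) m) →
  zipPad [] (rows S) (units (rows S)) ≡ tabulate (λ k → toList (lookup S k) , toList ⁅ k ⁆)
zip-rows-units S = trans
  (cong₂ (zipPad [])
    (trans (toList-map toList S)
      (trans (cong (map toList) (toList≡tabulate S)) (List.map-tabulate (lookup S) toList)))
    (units-toList (Vec.map toList S)))
  (zipPad-tabulate [] (toList ∘ lookup S) (toList ∘ ⁅_⁆))

map-tabulate-toList : ∀ {A X : Set} {k l} (F : A → List X) (f : Fin k → A) (g : Fin k → Vec X l) →
  (∀ i → F (f i) ≡ toList (g i)) → map F (tabulate f) ≡ map toList (tabulate g)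
map-tabulate-toList F f g eq = trans (List.map-tabulate f F)
  (trans (List.tabulate-cong eq) (sym (List.map-tabulate g toList)))

rules-toList : ∀ {n m} (S : Vec (Subset n) m) → rulesᴸ (falses n) (rows S) ≡ map toList (rules S)
rules-toList {n} {m} S = cong₂ _∷_
  (trans (cong₂ _++_ (map-const-toList _ (replicate n false)) (map-const-toList _ (Vec.map toList S)))
         (sym (toList-++ (replicate n (true , true)) (replicate m (false , true)))))
  (trans (cong₂ _++_
    (trans (cong (map _) (units-toList (replicate n false)))
      (map-tabulate-toList _ _ (ruleElement m) λ j →
        trans (cong₂ _++_ (sym (toList-map (_, false) ⁅ j ⁆)) (map-const-toList _ (Vec.map toList S)))
              (sym (toList-++ (Vec.map (_, false) ⁅ j ⁆) (replicate m (false , false))))))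
    (trans (cong (map _) (zip-rows-units S))
      (map-tabulate-toList _ _ (ruleSet S) λ k →
        trans (cong₂ _++_ (sym (toList-map (false ,_) (lookup S k))) (sym (toList-map (_, false) ⁅ k ⁆)))
              (sym (toList-++ (Vec.map (false ,_) (lookup S k)) (Vec.map (_, false) ⁅ k ⁆))))))
   (sym (List.map-++ toList (tabulate (ruleElement m)) (tabulate (ruleSet S)))))

edges-toList : ∀ {n m} (S : Vec (Subset n) m) → edgesᴸ (falses n) (rows S) ≡ map toList (edges S)
edges-toList {n} S = begin
  concat (map ruleEdgesᴸ (rulesᴸ (falses n) (rows S)))
    ≡⟨ cong (concat ∘ map ruleEdgesᴸ) (rules-toList S) ⟩
  concat (map ruleEdgesᴸ (map toList (rules S)))
    ≡⟨ cong concat (sym (List.map-∘ (rules S))) ⟩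
  concat (map (ruleEdgesᴸ ∘ toList) (rules S))
    ≡⟨ cong concat (List.map-cong (λ v → trans (ruleEdges-toList v)
                                                 (sym (List.map-tabulate (edge v) toList))) (rules S)) ⟩
  concatMap (map toList ∘ (λ v → tabulate (edge v))) (rules S)
    ≡⟨ List.map-concatMap toList (λ v → tabulate (edge v)) (rules S) ⟨
  map toList (edges S) ∎
  where open ≡-Reasoning

toList-half++half : ∀ {n m} (S : Vec (Subset n) m) k →
  (toList (lookup S k) ++ toList ⁅ k ⁆) ++ (toList (lookup S k) ++ toList ⁅ k ⁆) ≡ toList (block S k)
toList-half++half S k = trans (cong (λ h → h ++ h) (sym (toList-++ (lookup S k) ⁅ k ⁆)))
                              (sym (toList-++ (half S k) (half S k)))

blocks-toList : ∀ {n m} (S : Vec (Subset n) m) → blocksᴸ (rows S) ≡ rows (blocks S)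
blocks-toList S = begin
  blocksᴸ (rows S)                    ≡⟨ cong (map _) (zip-rows-units S) ⟩
  map _ (tabulate _)                  ≡⟨ map-tabulate-toList _ _ (block S) (toList-half++half S) ⟩
  map toList (tabulate (block S))     ≡⟨ cong (map toList) (toList-tabulate (block S)) ⟨
  map toList (toList (blocks S))      ≡⟨ toList-map toList (blocks S) ⟨
  rows (blocks S)                     ∎
  where open ≡-Reasoning

map-zipPad-toList : ∀ {A B C : Set} {k} (f : A → B → C) (d : B) (p : Vec A k) (q : Vec B k) →
  map (λ (x , y) → f x y) (zipPad d (toList p) (toList q)) ≡ toList (Vec.zipWith f p q)
map-zipPad-toList f d []      []      = refl
map-zipPad-toList f d (x ∷ p) (y ∷ q) = cong (f x y ∷_) (map-zipPad-toList f d p q)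

select-toList : ∀ {k m} (C : Subset k) (Ds : Vec (Subset k) m) →
  selectᴸ (toList C) (rows Ds) ≡ (toList (proj₁ (select C Ds)) , toList (proj₂ (select C Ds)))
select-toList C []       = refl
select-toList C (D ∷ Ds) rewrite select-toList C Ds = cong₂ _,_
  (map-zipPad-toList (λ x y → x ∧ not y) false rest D)
  (cong (λ r → or r ∷ toList (proj₂ (select C Ds))) (map-zipPad-toList _∧_ false rest D))
  where rest = proj₁ (select C Ds)

-- Encodings and the programs for both translations

encodeList≡encL : {X : Set} (enc : X → Tree) (xs : List X) → encodeList (map enc xs) ≡ encL enc xs
encodeList≡encL enc []       = refl
encodeList≡encL enc (x ∷ xs) = cong (enc x ∙_) (encodeList≡encL enc xs)

encodeSubset≡ : ∀ {n} (p : Subset n) → encodeSubset p ≡ encRow (toList p)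
encodeSubset≡ p = encodeList≡encL encodeBool (toList p)

-- As `encodeBool false` is `nil`, the ground set in unary is a row of `false`, to which the
-- programs on rows apply.
encodeSystem≡ : ∀ n (ps : List (Subset n)) →
  encodeSystem n ps ≡ encRow (falses n) ∙ encRows (map toList ps)
encodeSystem≡ n ps = cong₂ _∙_ (unary n) (subsets ps)
  where
  unary : ∀ n → encodeList (List.replicate n nil) ≡ encRow (falses n)
  unary zero    = refl
  unary (suc n) = cong (nil ∙_) (unary n)

  subsets : ∀ ps → encodeList (map encodeSubset ps) ≡ encRows (map toList ps)
  subsets []       = refl
  subsets (p ∷ ps) = cong₂ _∙_ (encodeSubset≡ p) (subsets ps)

encodeInstance≡ : ∀ I → let open SetSystem I in
  encodeSystem n (toList S) ≡ encRow (falses n) ∙ encRows (rows S)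
encodeInstance≡ I = trans (encodeSystem≡ n (toList S))
  (cong (λ r → encRow (falses n) ∙ encRows r) (sym (toList-map toList S)))
  where open SetSystem I

reduceP : Poly (encodeInstance SetCover) (encodeInstance MinCore ∘ reduce)
reduceP = congInputP (sym ∘ encodeInstance≡) (congP output
  (pairP (appendP vertices vertices) (edgesᴸP (hdP idP) (tlP idP))))
  where
  open SetSystem
  input : SetSystem → Tree
  input I = encRow (falses (n I)) ∙ encRows (rows (S I))

  -- The elements are counted by the unary ground set, the sets by the rows of the incidence matrix.
  vertices : Poly input (λ I → encRow (falses (n I) ++ map (const false) (rows (S I))))
  vertices = appendP (hdP idP) (mapP nilP (tlP {o = λ I → encRow (falses (n I))} idP))

  half-vertices : ∀ I → falses (n I) ++ map (const false) (rows (S I)) ≡ falses (n I + m I)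
  half-vertices I = trans (cong (falses (n I) ++_) (map-const-toList false (Vec.map toList (S I))))
                          (toList-replicate-+ (n I) (m I) false)

  output : ∀ I → let h = falses (n I) ++ map (const false) (rows (S I)) in
    encRow (h ++ h) ∙ encRows (edgesᴸ (falses (n I)) (rows (S I)))
      ≡ encodeSystem ((n I + m I) + (n I + m I)) (edges (S I))
  output I = trans
    (cong₂ (λ v e → encRow v ∙ encRows e)
      (trans (cong (λ h → h ++ h) (half-vertices I))
             (toList-replicate-+ (n I + m I) (n I + m I) false))
      (edges-toList (S I)))
    (sym (encodeSystem≡ _ (edges (S I))))

liftP : Poly {Σ[ I ∈ SetSystem ] ∃ (IsCore (reduce I))}
  (λ (I , s) → encodeInstance SetCover I ∙ encodeSubset (proj₁ s))
  (λ (I , s) → encodeSubset (proj₁ (lift I s)))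
liftP = congInputP (λ (I , C , _) → sym (cong₂ _∙_ (encodeInstance≡ I) (encodeSubset≡ C)))
  (congP (λ (I , C , core) → trans (cong encRow (selected I C)) (sym (encodeSubset≡ _)))
    (selectᴸP (tlP idP) (blocksᴸP (tlP (hdP idP)))))
  where
  selected : ∀ I C → proj₂ (selectᴸ (toList C) (blocksᴸ (rows (SetSystem.S I))))
                     ≡ toList (proj₂ (select C (blocks (SetSystem.S I))))
  selected I C = trans (cong (proj₂ ∘ selectᴸ (toList C)) (blocks-toList (SetSystem.S I)))
                       (cong proj₂ (select-toList C (blocks (SetSystem.S I))))

-- The factor 1 is `α` in one bound and `β` in the other.
fromℕ-mono : ∀ {m n} → m ≤ n → fromℕ m ℚ.≤ ℚ.1ℚ ℚ.* fromℕ n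
fromℕ-mono {m} {n} m≤n = subst (fromℕ m ℚ.≤_) (sym (ℚ.*-identityˡ (fromℕ n)))
  (ℚ.toℚᵘ-cancel-≤ (ℚᵘ.≤-respˡ-≃ (ℚᵘ.≃-sym (ℚ.toℚᵘ-fromℚᵘ (ℚᵘ.mkℚᵘ (ℤ.+ m) 0)))
    (ℚᵘ.≤-respʳ-≃ (ℚᵘ.≃-sym (ℚ.toℚᵘ-fromℚᵘ (ℚᵘ.mkℚᵘ (ℤ.+ n) 0)))
      (ℚᵘ.*≤* (ℤ.*-monoʳ-≤-nonNeg (ℤ.+ 1) (ℤ.+≤+ m≤n))))))

theorem22 : SetCover L-reduces-to MinCore
theorem22 = record
  { f           = reduce
  ; g           = lift
  ; f-polyTime  = toPolyTime reduceP
  ; g-polyTime  = toPolyTime liftP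
  ; α           = ℚ.1ℚ
  ; β           = ℚ.1ℚ
  ; α>0         = ℚ.positive⁻¹ ℚ.1ℚ
  ; β>0         = ℚ.positive⁻¹ ℚ.1ℚ
  ; OPT-bound   = λ I O O′ → fromℕ-mono (≤-reflexive (sym (opt-preserved I O O′)))
  ; error-bound = λ I O O′ s → fromℕ-mono (error-preserved I O O′ s)
  }
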